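{- (i) For all integers $k \geq 3$ and $1 \leq a, b \leq k-2$ with $a + b \geq k-1$, the graph $E_{k,a,b}$ is robustly critical. (ii) If $G$ is a robustly critical graph, then $G \vee K_t$ is robustly critical for any $t \in \mathbb{N}$.
   Context: All graphs are finite and simple. For an integer $k \geq 1$, a graph $G$ is $k$-critical if $\chi(G) = k$ and $\chi(G') < k$ for every proper subgraph $G'$ of $G$. The join $G \vee H$ of graphs $G$ and $H$ is obtained from vertex-disjoint copies of $G$ and $H$ by making every vertex of $G$ adjacent to every vertex of $H$. $K_t$ is the complete graph on $t$ vertices. The graph $E_{k,a,b}$: for integers $k \geq 3$ and $1 \leq a, b \leq k-2$ with $a+b \geq k-1$, let $X_1, X_2, Y_1, Y_2$ be disjoint sets with $|X_1| = a$, $|Y_1| = b$, $|X_2| = k-1-a$, $|Y_2| = k-1-b$, and let $z$ be an additional vertex. The vertex set of $E_{k,a,b}$ is $X_1 \cup X_2 \cup Y_1 \cup Y_2 \cup \{z\}$. The sets $X = X_1 \cup X_2$ and $Y = Y_1 \cup Y_2$ are cliques, the neighborhood of $z$ is $X_1 \cup Y_1$, and a vertex $x \in X$ is adjacent to $y \in Y$ if and only if $x \in X_2$ and $y \in Y_2$. A cover of a graph $G$ is a pair $\mathcal{H} = (L,H)$, where $H$ is a graph and $L$ is a function assigning to each $v \in V(G)$ a subset $L(v) \subseteq V(H)$ such that: the sets $L(v)$, $v \in V(G)$, are pairwise disjoint, independent in $H$, and have union $V(H)$; and whenever (for distinct $u,v\in V(G)$) the set $E_H(L(u),L(v))$ of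 edges of $H$ between $L(u)$ and $L(v)$ is nonempty, then $uv \in E(G)$ and $E_H(L(u),L(v))$ is a matching (not necessarily perfect). A proper $\mathcal{H}$-coloring of $G$ is an independent set $T$ of $H$ containing exactly one vertex from each $L(v)$; $G$ is $\mathcal{H}$-colorable if one exists, and otherwise $\mathcal{H}$ is a bad cover of $G$. A cover is $q$-fold if $|L(v)| = q$ for all $v \in V(G)$ (with $q = 0$ allowed). A $q$-fold cover $\mathcal{H} = (L,H)$ of $G$ is canonical if there is a mapping $\lambda \colon V(H) \to [q]$, where $[q]=\{1,\ldots,q\}$, such that for each $v \in V(G)$ the restriction $\lambda|_{L(v)}$ is a bijection from $L(v)$ to $[q]$, and for all $uv \in E(G)$, $c \in L(u)$, $c' \in L(v)$, we have $cc' \in E(H)$ if and only if $\lambda(c) = \lambda(c')$. (In particular the $0$-fold cover is canonical.) For $k \geq 1$, a graph $G$ is robustly $k$-critical if it is $k$-critical and every bad $(k-1)$-fold cover of $G$ is canonical. $G$ is robustly critical if it is robustly $k$-critical for some $k \geq 1$. -}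

module Defs where

import Data.Bool.Base as Bool
open import Data.Bool.Base using (Bool; true; false; T)
open import Data.Bool.Properties using (T?; T-irrelevant; ∨-comm)
open import Data.Fin.Base using (Fin; zero; suc)
open import Data.Fin.Properties using (_≟_; +↔⊎; inj⇒≟; 1↔⊤)
open import Data.Nat.Base using (ℕ; zero; suc; _+_; _∸_; _≤_; _<_)
open import Data.Product.Base using (Σ; Σ-syntax; ∃; ∃-syntax; _×_; _,_; proj₁; proj₂)
open import Data.Product using (∃!)
open import Data.Sum.Base using (_⊎_; inj₁; inj₂)
open import Data.Sum.Function.Propositional using (_⊎-↔_)
open import Data.Unit.Base using (⊤; tt)
open import Function.Base using (_∘_)
open import Function.Bundles using (_↔_; mk↔ₛ′; module Inverse)
open import Function.Definitions using (Bijective)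
open import Function.Properties.Inverse using (↔-refl; ↔-sym; ↔-trans; ↔⇒↣)
open import Level using (0ℓ)
open import Relation.Binary.Core using (Rel)
open import Relation.Binary.Definitions using (Decidable; DecidableEquality; Symmetric; Irreflexive)
open import Relation.Binary.PropositionalEquality
  using (_≡_; _≢_; refl; sym; trans; cong; subst; ≢-sym)
open import Relation.Nullary.Decidable using (yes; no; ¬?; _×-dec_)
open import Relation.Nullary.Negation using (¬_)

Finite : Set → Set
Finite A = ∃[ n ] (A ↔ Fin n)

-- Subsets are Boolean-valued, so that membership is decidable and
-- proof-irrelevant and Σ A (_∈ S) has exactly one element per member
-- of S.
Subset : Set → Set
Subset A = A → Bool

infix 4 _∈_
_∈_ : {A : Set} → A → Subset A → Set
x ∈ S = T (S x)

Elem : {A : Set} → Subset A → Set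
Elem S = Σ[ x ∈ _ ] (x ∈ S)

HasSize : {A : Set} → Subset A → ℕ → Set
HasSize S n = Elem S ↔ Fin n

finite-≟ : {A : Set} → Finite A → DecidableEquality A
finite-≟ (_ , A↔Fin) = inj⇒≟ (↔⇒↣ A↔Fin)

finite-⊎ : {A B : Set} → Finite A → Finite B → Finite (A ⊎ B)
finite-⊎ (m , A↔) (n , B↔) = m + n , ↔-trans (A↔ ⊎-↔ B↔) (↔-sym +↔⊎)

finite-↔ : {A B : Set} → A ↔ B → Finite B → Finite A
finite-↔ A↔B (n , B↔) = n , ↔-trans A↔B B↔

finite-T : (b : Bool) → Finite (T b)
finite-T true  = 1 , ↔-sym 1↔⊤
finite-T false = 0 , mk↔ₛ′ (λ ()) (λ ()) (λ ()) (λ ())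

finite-Fin-subset : (n : ℕ) (S : Subset (Fin n)) → Finite (Elem S)
finite-Fin-subset zero    S = 0 , mk↔ₛ′ (λ ()) (λ ()) (λ ()) (λ ())
finite-Fin-subset (suc n) S =
  finite-↔ (mk↔ₛ′ to from to∘from from∘to)
    (finite-⊎ (finite-T (S zero)) (finite-Fin-subset n (S ∘ suc)))
  where
  to : Elem S → T (S zero) ⊎ Elem (S ∘ suc)
  to (zero  , p) = inj₁ p
  to (suc i , p) = inj₂ (i , p)

  from : T (S zero) ⊎ Elem (S ∘ suc) → Elem S
  from (inj₁ p)       = zero , p
  from (inj₂ (i , p)) = suc i , p

  to∘from : ∀ y → to (from y) ≡ y
  to∘from (inj₁ _) = refl
  to∘from (inj₂ _) = refl

  from∘to : ∀ x → from (to x) ≡ x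
  from∘to (zero  , _) = refl
  from∘to (suc _ , _) = refl

Elem-≡ : {A : Set} (S : Subset A) {x y : Elem S} → proj₁ x ≡ proj₁ y → x ≡ y
Elem-≡ S {x , p} {.x , q} refl = cong (x ,_) (T-irrelevant p q)

finite-subset : {A : Set} → Finite A → (S : Subset A) → Finite (Elem S)
finite-subset {A} (n , A↔Fin) S =
  finite-↔ (mk↔ₛ′ fwd bwd fwd∘bwd bwd∘fwd) (finite-Fin-subset n (S ∘ from))
  where
  open Inverse A↔Fin using (to; from; strictlyInverseˡ; strictlyInverseʳ)

  fwd : Elem S → Elem (S ∘ from)
  fwd (x , p) = to x , subst (_∈ S) (sym (strictlyInverseʳ x)) p

  bwd : Elem (S ∘ from) → Elem S
  bwd (i , p) = from i , p

  fwd∘bwd : ∀ y → fwd (bwd y) ≡ y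
  fwd∘bwd (i , _) = Elem-≡ (S ∘ from) (strictlyInverseˡ i)

  bwd∘fwd : ∀ x → bwd (fwd x) ≡ x
  bwd∘fwd (x , _) = Elem-≡ S (strictlyInverseʳ x)

record Graph : Set₁ where
  infix 4 _~_ _~?_
  field
    V        : Set
    V-finite : Finite V
    _~_      : Rel V 0ℓ
    _~?_     : Decidable _~_
    ~-sym    : Symmetric _~_
    ~-irrefl : Irreflexive _≡_ _~_

open Graph using (V)

_⟨_~_⟩ : (G : Graph) → V G → V G → Set
G ⟨ u ~ v ⟩ = Graph._~_ G u v

record Subgraph (G : Graph) : Set₁ where
  field
    vertices  : Subset (V G)
    edge      : Rel (V G) 0ℓ
    edge?     : Decidable edge
    edge-sym  : Symmetric edge
    edge-⊆    : ∀ {u v} → edge u v → G ⟨ u ~ v ⟩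
    edge-ends : ∀ {u v} → edge u v → u ∈ vertices × v ∈ vertices

  graph : Graph
  graph = record
    { V        = Elem vertices
    ; V-finite = finite-subset (Graph.V-finite G) vertices
    ; _~_      = λ u v → edge (proj₁ u) (proj₁ v)
    ; _~?_     = λ u v → edge? (proj₁ u) (proj₁ v)
    ; ~-sym    = edge-sym
    ; ~-irrefl = λ { refl e → Graph.~-irrefl G refl (edge-⊆ e) }
    }

  Proper : Set
  Proper = ¬ ((∀ v → v ∈ vertices) × (∀ {u v} → G ⟨ u ~ v ⟩ → edge u v))

complete : ℕ → Graph
complete t = record
  { V        = Fin t
  ; V-finite = t , ↔-refl
  ; _~_      = _≢_
  ; _~?_     = λ u v → ¬? (u ≟ v)
  ; ~-sym    = ≢-sym
  ; ~-irrefl = λ u≡v u≢v → u≢v u≡v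
  }

infixr 6 _∨_
_∨_ : Graph → Graph → Graph
G ∨ H = record
  { V        = V G ⊎ V H
  ; V-finite = finite-⊎ (Graph.V-finite G) (Graph.V-finite H)
  ; _~_      = adj
  ; _~?_     = adj?
  ; ~-sym    = λ {u} {v} → adj-sym u v
  ; ~-irrefl = λ { {u} refl → adj-irrefl u }
  }
  where
  adj : Rel (V G ⊎ V H) 0ℓ
  adj (inj₁ u) (inj₁ v) = G ⟨ u ~ v ⟩
  adj (inj₂ u) (inj₂ v) = H ⟨ u ~ v ⟩
  adj (inj₁ _) (inj₂ _) = ⊤
  adj (inj₂ _) (inj₁ _) = ⊤

  adj? : Decidable adj
  adj? (inj₁ u) (inj₁ v) = Graph._~?_ G u v
  adj? (inj₂ u) (inj₂ v) = Graph._~?_ H u v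
  adj? (inj₁ _) (inj₂ _) = yes tt
  adj? (inj₂ _) (inj₁ _) = yes tt

  adj-sym : ∀ u v → adj u v → adj v u
  adj-sym (inj₁ _) (inj₁ _) = Graph.~-sym G
  adj-sym (inj₂ _) (inj₂ _) = Graph.~-sym H
  adj-sym (inj₁ _) (inj₂ _) = λ _ → tt
  adj-sym (inj₂ _) (inj₁ _) = λ _ → tt

  adj-irrefl : ∀ u → ¬ adj u u
  adj-irrefl (inj₁ _) = Graph.~-irrefl G refl
  adj-irrefl (inj₂ _) = Graph.~-irrefl H refl

Colorable : Graph → ℕ → Set
Colorable G k = Σ[ c ∈ (V G → Fin k) ] (∀ {u v} → G ⟨ u ~ v ⟩ → c u ≢ c v)

χ[_]≡_ : Graph → ℕ → Set
χ[ G ]≡ k = Colorable G k × (∀ j → j < k → ¬ Colorable G j)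

χ[_]<_ : Graph → ℕ → Set
χ[ G ]< k = ∃[ j ] (χ[ G ]≡ j × j < k)

Critical : ℕ → Graph → Set₁
Critical k G =
  χ[ G ]≡ k × ((S : Subgraph G) → Subgraph.Proper S → χ[ Subgraph.graph S ]< k)

Independent : (H : Graph) → Subset (V H) → Set
Independent H S = ∀ {x y} → x ∈ S → y ∈ S → ¬ H ⟨ x ~ y ⟩

EdgeBetween : (H : Graph) (A B : Subset (V H)) → V H → V H → Set
EdgeBetween H A B x y = x ∈ A × y ∈ B × H ⟨ x ~ y ⟩

-- For disjoint A and B, a common
-- end is either the A-end of both edges or the B-end of both.
IsMatching : (H : Graph) (A B : Subset (V H)) → Set
IsMatching H A B =
  (∀ {x y y′} → EdgeBetween H A B x y → EdgeBetween H A B x y′ → y ≡ y′) ×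
  (∀ {x x′ y} → EdgeBetween H A B x y → EdgeBetween H A B x′ y → x ≡ x′)

record Cover (G : Graph) : Set₁ where
  field
    H           : Graph
    L           : V G → Subset (V H)
    disjoint    : ∀ {u v} → u ≢ v → ∀ x → ¬ (x ∈ L u × x ∈ L v)
    independent : ∀ v → Independent H (L v)
    union       : ∀ x → ∃[ v ] (x ∈ L v)
    between     : ∀ {u v} → u ≢ v →
                  (∃[ x ] ∃[ y ] EdgeBetween H (L u) (L v) x y) →
                  G ⟨ u ~ v ⟩ × IsMatching H (L u) (L v)

  ProperColoring : Subset (V H) → Set
  ProperColoring S =
    Independent H S × (∀ v → ∃! _≡_ (λ x → x ∈ L v × x ∈ S))

  Bad : Set
  Bad = ¬ ∃ ProperColoring

  Fold : ℕ → Set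
  Fold q = ∀ v → HasSize (L v) q

  -- Meant for covers that satisfy Fold q.
  Canonical : ℕ → Set
  Canonical q = Σ[ lab ∈ (V H → Fin q) ]
    ((∀ v → Bijective {A = Elem (L v)} _≡_ _≡_ (lab ∘ proj₁)) ×
     (∀ {u v} → G ⟨ u ~ v ⟩ → ∀ {c c′} → c ∈ L u → c′ ∈ L v →
       (H ⟨ c ~ c′ ⟩ → lab c ≡ lab c′) × (lab c ≡ lab c′ → H ⟨ c ~ c′ ⟩)))

-- Meant for k ≥ 1.
RobustlyKCritical : ℕ → Graph → Set₁
RobustlyKCritical k G =
  Critical k G ×
  ((C : Cover G) → Cover.Fold C (k ∸ 1) → Cover.Bad C → Cover.Canonical C (k ∸ 1))

RobustlyCritical : Graph → Set₁
RobustlyCritical G = ∃[ k ] (1 ≤ k × RobustlyKCritical k G)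

data EVertex (k a b : ℕ) : Set where
  x₁ : Fin a → EVertex k a b
  x₂ : Fin (k ∸ 1 ∸ a) → EVertex k a b
  y₁ : Fin b → EVertex k a b
  y₂ : Fin (k ∸ 1 ∸ b) → EVertex k a b
  z  : EVertex k a b

module _ {k a b : ℕ} where

  X₁ X₂ Y₁ Y₂ X Y Z : Subset (EVertex k a b)
  X₁ (x₁ _) = true
  X₁ _      = false
  X₂ (x₂ _) = true
  X₂ _      = false
  Y₁ (y₁ _) = true
  Y₁ _      = false
  Y₂ (y₂ _) = true
  Y₂ _      = false
  X v = X₁ v Bool.∨ X₂ v
  Y v = Y₁ v Bool.∨ Y₂ v
  Z z = true
  Z _ = false

  -- The prescribed edges, each pair in at least one of its two orders;
  -- E-adj is the symmetric closure with loops removed.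
  prescribed : EVertex k a b → EVertex k a b → Bool
  prescribed u v =
    (X u Bool.∧ X v) Bool.∨
    (Y u Bool.∧ Y v) Bool.∨
    (Z u Bool.∧ (X₁ v Bool.∨ Y₁ v)) Bool.∨
    (X₂ u Bool.∧ Y₂ v)

  E-adj : Rel (EVertex k a b) 0ℓ
  E-adj u v = u ≢ v × T (prescribed u v Bool.∨ prescribed v u)

  finite-EVertex : Finite (EVertex k a b)
  finite-EVertex =
    finite-↔ (mk↔ₛ′ to from to∘from from∘to)
      (finite-⊎ (_ , ↔-refl) (finite-⊎ (_ , ↔-refl)
        (finite-⊎ (_ , ↔-refl) (finite-⊎ (_ , ↔-refl) (1 , ↔-sym 1↔⊤)))))
    where
    Code : Set
    Code = Fin a ⊎ Fin (k ∸ 1 ∸ a) ⊎ Fin b ⊎ Fin (k ∸ 1 ∸ b) ⊎ ⊤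

    to : EVertex k a b → Code
    to (x₁ i) = inj₁ i
    to (x₂ i) = inj₂ (inj₁ i)
    to (y₁ i) = inj₂ (inj₂ (inj₁ i))
    to (y₂ i) = inj₂ (inj₂ (inj₂ (inj₁ i)))
    to z      = inj₂ (inj₂ (inj₂ (inj₂ tt)))

    from : Code → EVertex k a b
    from (inj₁ i)                      = x₁ i
    from (inj₂ (inj₁ i))               = x₂ i
    from (inj₂ (inj₂ (inj₁ i)))        = y₁ i
    from (inj₂ (inj₂ (inj₂ (inj₁ i)))) = y₂ i
    from (inj₂ (inj₂ (inj₂ (inj₂ _)))) = z

    to∘from : ∀ c → to (from c) ≡ c
    to∘from (inj₁ _)                      = refl
    to∘from (inj₂ (inj₁ _))               = refl
    to∘from (inj₂ (inj₂ (inj₁ _)))        = refl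
    to∘from (inj₂ (inj₂ (inj₂ (inj₁ _)))) = refl
    to∘from (inj₂ (inj₂ (inj₂ (inj₂ _)))) = refl

    from∘to : ∀ v → from (to v) ≡ v
    from∘to (x₁ _) = refl
    from∘to (x₂ _) = refl
    from∘to (y₁ _) = refl
    from∘to (y₂ _) = refl
    from∘to z      = refl

-- Meant for k ≥ 3, 1 ≤ a, b ≤ k - 2 and a + b ≥ k - 1.
E : ℕ → ℕ → ℕ → Graph
E k a b = record
  { V        = EVertex k a b
  ; V-finite = finite-EVertex
  ; _~_      = E-adj
  ; _~?_     = λ u v → ¬? (finite-≟ finite-EVertex u v) ×-dec T? _
  ; ~-sym    = λ {u} {v} → λ (u≢v , e) →
                 ≢-sym u≢v , subst T (∨-comm (prescribed u v) (prescribed v u)) e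
  ; ~-irrefl = λ u≡v (u≢v , _) → u≢v u≡v
  }

{-# OPTIONS --safe #-}

-- Numbering the colors at every vertex turns a q-fold cover into a family
-- of partial matchings of Fin q with itself.  Once every bad q-fold cover
-- is known to be canonical, edge-criticality is automatic: deleting an edge
-- from the diagonal cover leaves a non-canonical cover, which must be
-- colorable.
--
-- (i) Let q = k - 1.  Color E_{k,a,b} greedily in the order z, X₂, Y₂, X₁,
-- Y₁.  Only the last vertex x of X₁ and the last vertex y of Y₁ can get
-- stuck, and they do not if among their q colored neighbors two forbid the
-- same color ("agree").  For any color of z there is a color of a given
-- vertex of X₂ that agrees with it at x, and similarly for Y₂ and y; so in
-- a bad cover two such colors must be adjacent.  This forces the matchings
-- along z - X₁ - X₂ - Y₂ - Y₁ - z to be perfect and consistent, and further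
-- precolorings handle the edges inside X and inside Y.
--
-- (ii) It suffices to add one vertex w.  Choosing a color c of w removes at
-- most one color from every other vertex and leaves a bad cover of G, which
-- is therefore canonical with perfect matchings.  Comparing different c
-- shows that every matching sends the neighbor of c to the neighbor of c.

module Submission where

open import Defs
import Data.Bool.Base as Bool
open Bool using (T)
open import Data.Bool.Properties using (T?; T-irrelevant)
open import Data.Empty using (⊥; ⊥-elim)
open import Data.Fin.Base using (Fin; zero; suc; punchIn; punchOut; inject≤; fromℕ<;
                                join; splitAt; cast)
open import Data.Fin.Properties
  using (_≟_; any?; all?; injective⇒≤; suc-injective; inject≤-injective;
         punchIn-injective; punchInᵢ≢i; punchIn-punchOut; punchOut-injective;
         splitAt-join; join-splitAt; cast-involutive; *↔×)
open import Data.List.Base using (List; []; _∷_; map; allFin)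
open import Data.List.Membership.Propositional using (find) renaming (_∈_ to _∈ˡ_; _∉_ to _∉ˡ_)
open import Data.List.Membership.Propositional.Properties using (∈-map⁺; ∈-allFin)
open import Data.List.Relation.Unary.All as All using (All; []; _∷_)
open import Data.List.Relation.Unary.All.Properties using (¬Any⇒All¬)
open import Data.List.Relation.Unary.AllPairs using (AllPairs; []; _∷_)
open import Data.List.Relation.Unary.Any as Any using (here; there)
open import Data.Nat.Base using (ℕ; zero; suc; _+_; _∸_; _≤_; _<_; z≤n; s≤s; s≤s⁻¹)
open import Data.Nat.Properties as ℕ
  using (≤-refl; ≤-reflexive; ≤-trans; <⇒≤; n≤1+n; 1+n≰n; m≤n⇒m<n∨m≡n; m<n⇒0<n∸m;
         m+[n∸m]≡n; m∸n+n≡m; m≤n+o⇒m∸n≤o; +-comm; +-monoʳ-≤)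
open import Data.Product using (∃!)
open import Data.Product.Base using (Σ-syntax; ∃; ∃-syntax; _×_; _,_; proj₁; proj₂)
open import Data.Product.Function.NonDependent.Propositional using (_×-↔_)
open import Data.Sum.Base using (_⊎_; inj₁; inj₂; [_,_]′)
open import Data.Unit.Base using (⊤; tt)
import Data.Vec.Functional as Vector
open import Function.Base using (_∘_; id)
open import Function.Bundles using (mk↔ₛ′; module Inverse; module Injection)
open import Function.Definitions using (Injective; Bijective)
open import Function.Properties.Inverse using (↔-refl; ↔-sym; ↔-trans; ↔⇒↣)
open import Level using (0ℓ)
open import Relation.Binary.Core using (Rel)
open import Relation.Binary.Definitions using (Decidable; DecidableEquality; Symmetric)
open import Relation.Binary.PropositionalEquality
  using (_≡_; _≢_; refl; sym; trans; cong; subst; subst₂)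
open import Relation.Nullary.Decidable
  using (Dec; yes; no; map′; ¬?; _×-dec_; decidable-stable; isNo; isYes;
         toWitness; fromWitness; toWitnessFalse; fromWitnessFalse)
open import Relation.Nullary.Negation using (¬_; contradiction)

open Graph using (V)

-- Finite search

vertex-≟ : (G : Graph) → DecidableEquality (V G)
vertex-≟ G = finite-≟ (Graph.V-finite G)

finite-any? : {A : Set} → Finite A → {P : A → Set} → (∀ x → Dec (P x)) → Dec (∃ P)
finite-any? (_ , A↔Fin) {P} P? =
  map′ (λ (i , p) → from i , p)
       (λ (x , p) → to x , subst P (sym (strictlyInverseʳ x)) p)
       (any? (P? ∘ from))
  where open Inverse A↔Fin

finite-all? : {A : Set} → Finite A → {P : A → Set} → (∀ x → Dec (P x)) → Dec (∀ x → P x)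
finite-all? (_ , A↔Fin) {P} P? =
  map′ (λ h x → subst P (strictlyInverseʳ x) (h (to x))) (λ h → h ∘ from) (all? (P? ∘ from))
  where open Inverse A↔Fin

-- The search tries each value at `zero` and recurses on the rest. A function agrees with its
-- rebuilt copy only pointwise, so `P` has to respect pointwise equality.
any-function? : ∀ n {j} {P : (Fin n → Fin j) → Set} →
  (∀ {f g} → (∀ x → f x ≡ g x) → P f → P g) → (∀ f → Dec (P f)) → Dec (∃ P)
any-function? zero resp P? =
  map′ (λ p → _ , p) (λ (_ , p) → resp (λ ()) p) (P? (λ ()))
any-function? (suc n) resp P? =
  map′ (λ (i , f , p) → (i Vector.∷ f) , p)
       (λ (f , p) → f zero , f ∘ suc , resp (λ { zero → refl ; (suc _) → refl }) p)
       (any? λ i → any-function? n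
         (λ e → resp λ { zero → refl ; (suc x) → e x }) (P? ∘ (i Vector.∷_)))

finite-any-function? : {A : Set} → Finite A → ∀ {j} {P : (A → Fin j) → Set} →
  (∀ {f g} → (∀ x → f x ≡ g x) → P f → P g) → (∀ f → Dec (P f)) → Dec (∃ P)
finite-any-function? (n , A↔Fin) resp P? =
  map′ (λ (f , p) → f ∘ to , p)
       (λ (f , p) → f ∘ from , resp (λ x → sym (cong f (strictlyInverseʳ x))) p)
       (any-function? n (λ e → resp (e ∘ to)) (P? ∘ (_∘ to)))
  where open Inverse A↔Fin

-- Pigeonhole: punching out a missed value would inject `Fin (suc n)` into `Fin n`.
injective⇒surjective : ∀ {n} (f : Fin n → Fin n) → Injective _≡_ _≡_ f → ∀ j → ∃[ i ] f i ≡ j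
injective⇒surjective {suc n} f inj j with any? (λ i → f i ≟ j)
... | yes hit = hit
... | no miss = contradiction (injective⇒≤ {f = g} g-injective) 1+n≰n
  where
  j≢f : ∀ i → j ≢ f i
  j≢f i e = miss (i , sym e)

  g : Fin (suc n) → Fin n
  g i = punchOut (j≢f i)

  g-injective : Injective _≡_ _≡_ g
  g-injective {i} {i′} e = inj (punchOut-injective (j≢f i) (j≢f i′) e)

-- Numbered covers and robustness

-- A cover with the colors of every vertex numbered by Fin q:
-- M u v i j says that color i of u is adjacent to color j of v.
record DPCover (G : Graph) (q : ℕ) : Set₁ where
  field
    M            : V G → V G → Fin q → Fin q → Set
    M?           : ∀ u v i j → Dec (M u v i j)
    M-sym        : ∀ {u v i j} → M u v i j → M v u j i
    M-functional : ∀ {u v i j j′} → M u v i j → M u v i j′ → j ≡ j′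
    M-edge       : ∀ {u v i j} → M u v i j → G ⟨ u ~ v ⟩

  M-injective : ∀ {u v i i′ j} → M u v i j → M u v i′ j → i ≡ i′
  M-injective m m′ = M-functional (M-sym m) (M-sym m′)

  IsColoring : (V G → Fin q) → Set
  IsColoring f = ∀ u v → ¬ M u v (f u) (f v)

  Uncolorable : Set
  Uncolorable = ¬ ∃ IsColoring

  -- The numbered form of `Canonical`: `col v c` is the color of `v` labelled `c`. Each `col v` is a
  -- bijection and `M` a partial matching, so joining equal labels also rules out edges between
  -- different ones.
  Aligned : Set
  Aligned = Σ[ col ∈ (V G → Fin q → Fin q) ]
    (∀ v → Injective _≡_ _≡_ (col v)) ×
    (∀ {u v} → G ⟨ u ~ v ⟩ → ∀ c → M u v (col u c) (col v c))

  Perfect : Set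
  Perfect = ∀ {u v} → G ⟨ u ~ v ⟩ → ∀ i → ∃[ j ] M u v i j

  aligned⇒perfect : Aligned → Perfect
  aligned⇒perfect (col , col-inj , col-M) {u} {v} u~v i
    with c , refl ← injective⇒surjective (col u) (col-inj u) i = col v c , col-M u~v c

  isColoring? : ∀ f → Dec (IsColoring f)
  isColoring? f = finite-all? fin λ u → finite-all? fin λ v → ¬? (M? u v (f u) (f v))
    where fin = Graph.V-finite G

  -- Decidability makes arguments by contradiction constructive: refuting `Uncolorable` yields an
  -- actual coloring.
  coloring? : Dec (∃ IsColoring)
  coloring? = finite-any-function? (Graph.V-finite G)
    (λ e h u v m → h u v (subst₂ (M u v) (sym (e u)) (sym (e v)) m)) isColoring?

-- Its colorings are the ordinary proper `q`-colorings of the spanning subgraph with edge relation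
-- `edge`.
diagonal : ∀ {G} q (edge : Rel (V G) 0ℓ) → Decidable edge → Symmetric edge →
  (∀ {u v} → edge u v → G ⟨ u ~ v ⟩) → DPCover G q
diagonal q edge edge? edge-sym edge-⊆ = record
  { M            = λ u v i j → edge u v × i ≡ j
  ; M?           = λ u v i j → edge? u v ×-dec (i ≟ j)
  ; M-sym        = λ (e , i≡j) → edge-sym e , sym i≡j
  ; M-functional = λ (_ , p) (_ , p′) → trans (sym p) p′
  ; M-edge       = edge-⊆ ∘ proj₁
  }

-- Color zero is reserved for w, so that the remaining q colors
-- properly color G - w.
ColorableWithout : (G : Graph) → ℕ → V G → Set
ColorableWithout G q w = Σ[ c ∈ (V G → Fin (suc q)) ]
  (∀ {u v} → G ⟨ u ~ v ⟩ → c u ≢ c v) × (∀ v → c v ≡ zero → v ≡ w)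

-- The working form of robust k-criticality for q = k - 1; the equivalence is
-- `robust⇒robustly-critical` and `robustly-critical⇒robust`.
record Robust (q : ℕ) (G : Graph) : Set₁ where
  field
    uncolorable   : ¬ Colorable G q
    delete-vertex : ∀ w → ColorableWithout G q w
    aligned       : (D : DPCover G q) → DPCover.Uncolorable D → DPCover.Aligned D

fin-one-unique : (i : Fin 1) → i ≡ zero
fin-one-unique zero = refl

module _ {q : ℕ} {G : Graph} (R : Robust q G) where
  open Robust R

  -- An edge forces `q` to be positive: for q = 0 the only color in `delete-vertex u` is the one
  -- reserved for `u`, so both ends would be `u`.
  robust-color : ∀ {u v} → G ⟨ u ~ v ⟩ → Fin q
  robust-color {u} {v} u~v = go q (delete-vertex u)
    where
    go : ∀ q → ColorableWithout G q u → Fin q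
    go zero (c , _ , c-zero) =
      contradiction u~v (Graph.~-irrefl G (sym (c-zero v (fin-one-unique (c v)))))
    go (suc q) _ = zero

-- A diagonal cover with a missing edge is not perfect, hence it is
-- colorable.
missing-edge-colorable : ∀ {q G} → Fin q →
  ((D : DPCover G q) → DPCover.Uncolorable D → DPCover.Aligned D) →
  (edge : Rel (V G) 0ℓ) → Decidable edge → Symmetric edge →
  (∀ {u v} → edge u v → G ⟨ u ~ v ⟩) → ∀ {u v} → G ⟨ u ~ v ⟩ → ¬ edge u v →
  Σ[ c ∈ (V G → Fin q) ] (∀ {u v} → edge u v → c u ≢ c v)
missing-edge-colorable {q} {G} i aligned edge edge? edge-sym edge-⊆ u~v ¬e =
  let c , h = decidable-stable (DPCover.coloring? D) λ unc →
        ¬e (proj₁ (proj₂ (proj₂ (aligned D unc)) u~v i))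
  in c , λ e p → h _ _ (e , p)
  where
  D : DPCover G q
  D = diagonal q edge edge? edge-sym edge-⊆

-- Criticality versus robustness

colorable-mono : ∀ G {j k} → j ≤ k → Colorable G j → Colorable G k
colorable-mono _ j≤k (c , h) =
  (λ v → inject≤ (c v) j≤k) , λ e p → h e (inject≤-injective j≤k j≤k _ _ p)

colorable? : ∀ G k → Dec (Colorable G k)
colorable? G k =
  map′ (λ (c , h) → c , λ e p → h _ _ (e , p)) (λ (c , h) → c , λ _ _ (e , p) → h e p)
       (DPCover.coloring? (diagonal {G} k (Graph._~_ G) (Graph._~?_ G) (Graph.~-sym G) λ e → e))

chromatic-number : ∀ G k → Colorable G k → ∃[ j ] (χ[ G ]≡ j × j < suc k)
chromatic-number _ zero c = zero , (c , λ _ ()) , s≤s z≤n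
chromatic-number G (suc k) c with colorable? G k
... | yes c′ = let j , χ , j<k = chromatic-number G k c′ in j , χ , ≤-trans j<k (n≤1+n _)
... | no ¬c′ = suc k , (c , λ { j (s≤s j≤k) c″ → ¬c′ (colorable-mono G j≤k c″) }) , ≤-refl

module _ {q : ℕ} {G : Graph} (R : Robust q G) where
  open Robust R
  open Graph G using (_~_; _~?_; ~-sym; V-finite)

  -- A proper subgraph either misses a vertex `w`, and then the color reserved for `w` can be
  -- punched out, or has all vertices and misses an edge, and then the diagonal cover of its edges
  -- is colorable.
  subgraph-colorable : (S : Subgraph G) → Subgraph.Proper S → Colorable (Subgraph.graph S) q
  subgraph-colorable S proper with finite-any? V-finite (λ v → ¬? (T? (Subgraph.vertices S v)))
  ... | yes (w , w∉S) =
    (λ (v , v∈S) → punchOut (nonzero v v∈S)) ,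
    λ {(u , u∈S)} {(v , v∈S)} e p →
      proper-c (edge-⊆ e) (punchOut-injective (nonzero u u∈S) (nonzero v v∈S) p)
    where
    open Subgraph S
    c = proj₁ (delete-vertex w)
    proper-c = proj₁ (proj₂ (delete-vertex w))
    nonzero : ∀ v → v ∈ vertices → zero ≢ c v
    nonzero v v∈S 0≡c =
      w∉S (subst (_∈ vertices) (proj₂ (proj₂ (delete-vertex w)) v (sym 0≡c)) v∈S)
  ... | no all∈S with finite-any? V-finite (λ u → finite-any? V-finite (λ v →
                        (u ~? v) ×-dec ¬? (Subgraph.edge? S u v)))
  ...   | yes (u , v , u~v , ¬e) =
    let open Subgraph S
        c , h = missing-edge-colorable (robust-color R u~v) aligned
                  edge edge? edge-sym edge-⊆ u~v ¬e
    in c ∘ proj₁ , λ e → h e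
  ...   | no all-edges = contradiction
    ( (λ v → decidable-stable (T? (vertices v)) λ v∉S → all∈S (v , v∉S))
    , (λ {u} {v} u~v → decidable-stable (edge? u v) λ ¬e → all-edges (u , v , u~v , ¬e)) )
    proper
    where open Subgraph S

  robust⇒critical : Critical (suc q) G
  robust⇒critical =
    (colorable , λ { j (s≤s j≤q) c → uncolorable (colorable-mono G j≤q c) }) ,
    λ S proper → chromatic-number (Subgraph.graph S) q (subgraph-colorable S proper)
    where
    colorable : Colorable G (suc q)
    colorable with finite-any? V-finite (λ _ → yes tt)
    ... | yes (w , _) = let c , h , _ = delete-vertex w in c , h
    ... | no empty = contradiction
      ((λ v → ⊥-elim (empty (v , tt))) , λ {u} {_} _ _ → empty (u , tt)) uncolorable

critical⇒uncolorable : ∀ {q G} → Critical (suc q) G → ¬ Colorable G q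
critical⇒uncolorable ((_ , least) , _) = least _ ≤-refl

module _ {G : Graph} {q : ℕ} {w : V G} (c : ∀ v → v ≢ w → Fin q)
  (c-proper : ∀ {u v} → G ⟨ u ~ v ⟩ → (u≢w : u ≢ w) (v≢w : v ≢ w) → c u u≢w ≢ c v v≢w) where

  private
    _≟ⱽ_ = vertex-≟ G

    c₀ : V G → Fin (suc q)
    c₀ v with v ≟ⱽ w
    ... | yes _  = zero
    ... | no v≢w = suc (c v v≢w)

    c₀-proper : ∀ {u v} → G ⟨ u ~ v ⟩ → c₀ u ≢ c₀ v
    c₀-proper {u} {v} u~v p with u ≟ⱽ w | v ≟ⱽ w
    ... | yes u≡w | yes v≡w = Graph.~-irrefl G (trans u≡w (sym v≡w)) u~v
    ... | no u≢w  | no v≢w  = c-proper u~v u≢w v≢w (suc-injective p)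
    c₀-proper u~v () | yes _ | no _
    c₀-proper u~v () | no _ | yes _

    c₀-zero : ∀ v → c₀ v ≡ zero → v ≡ w
    c₀-zero v p with v ≟ⱽ w
    ... | yes v≡w = v≡w
    c₀-zero v () | no _

  extend-by-zero : ColorableWithout G q w
  extend-by-zero = c₀ , c₀-proper , c₀-zero

critical⇒delete-vertex : ∀ {q G} → Critical (suc q) G → ∀ w → ColorableWithout G q w
critical⇒delete-vertex {q} {G} (_ , subcritical) w = extend-by-zero {G = G}
  (λ v v≢w → proj₁ G-w-colorable (v , fromWitnessFalse v≢w))
  (λ e u≢w v≢w → proj₂ G-w-colorable (e , u≢w , v≢w))
  where
  open Graph G using (_~_; _~?_; ~-sym; ~-irrefl)
  _≟ⱽ_ = vertex-≟ G

  G-w : Subgraph G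
  G-w = record
    { vertices  = λ v → isNo (v ≟ⱽ w)
    ; edge      = λ u v → u ~ v × u ≢ w × v ≢ w
    ; edge?     = λ u v → (u ~? v) ×-dec ¬? (u ≟ⱽ w) ×-dec ¬? (v ≟ⱽ w)
    ; edge-sym  = λ (e , p , p′) → ~-sym e , p′ , p
    ; edge-⊆    = proj₁
    ; edge-ends = λ (_ , p , p′) → fromWitnessFalse p , fromWitnessFalse p′
    }

  G-w-colorable : Colorable (Subgraph.graph G-w) q
  G-w-colorable with subcritical G-w (λ (all , _) → toWitnessFalse (all w) refl)
  ... | j , (c , _) , s≤s j≤q = colorable-mono (Subgraph.graph G-w) j≤q c

-- Numbered covers versus covers

module _ {G : Graph} {q : ℕ} (C : Cover G) (fold : Cover.Fold C q) where
  open Cover C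

  private
    color : V G → Fin q → V H
    color v i = proj₁ (Inverse.from (fold v) i)

    color∈L : ∀ v i → color v i ∈ L v
    color∈L v i = proj₂ (Inverse.from (fold v) i)

    index : ∀ v {x} → x ∈ L v → Fin q
    index v x∈Lv = Inverse.to (fold v) (_ , x∈Lv)

    color-index : ∀ v {x} (x∈Lv : x ∈ L v) → color v (index v x∈Lv) ≡ x
    color-index v x∈Lv = cong proj₁ (Inverse.strictlyInverseʳ (fold v) _)

    color-injective : ∀ v {i j} → color v i ≡ color v j → i ≡ j
    color-injective v p =
      Injection.injective (↔⇒↣ (↔-sym (fold v))) (Elem-≡ (L v) p)

    owner : V H → V G
    owner x = proj₁ (union x)

    owner-unique : ∀ {x v} → x ∈ L v → owner x ≡ v
    owner-unique {x} {v} x∈Lv = decidable-stable (vertex-≟ G _ _) λ owner≢v →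
      disjoint owner≢v x (proj₂ (union x) , x∈Lv)

    adjacent⇒≢ : ∀ {u v i j} → H ⟨ color u i ~ color v j ⟩ → u ≢ v
    adjacent⇒≢ {u} e refl = independent u (color∈L u _) (color∈L u _) e

    between-colors : ∀ {u v i j} → H ⟨ color u i ~ color v j ⟩ →
      G ⟨ u ~ v ⟩ × IsMatching H (L u) (L v)
    between-colors e = between (adjacent⇒≢ e) (_ , _ , color∈L _ _ , color∈L _ _ , e)

  numbered : DPCover G q
  numbered = record
    { M            = λ u v i j → H ⟨ color u i ~ color v j ⟩
    ; M?           = λ u v i j → Graph._~?_ H _ _
    ; M-sym        = Graph.~-sym H
    ; M-functional = λ {u} {v} e e′ → color-injective v
        (proj₁ (proj₂ (between-colors e))
          (color∈L u _ , color∈L v _ , e) (color∈L u _ , color∈L v _ , e′))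
    ; M-edge       = proj₁ ∘ between-colors
    }

  open DPCover numbered using (IsColoring; Uncolorable; Aligned; M)

  bad⇒uncolorable : Bad → Uncolorable
  bad⇒uncolorable bad (f , f-coloring) = bad (S , S-independent , S-transversal)
    where
    _≟ᴴ_ = vertex-≟ H

    -- Out of the list of its owner, `x` is selected when it is the color that `f` chooses there.
    S : Subset (V H)
    S x = isYes (x ≟ᴴ color (owner x) (f (owner x)))

    S-independent : Independent H S
    S-independent {x} {y} x∈S y∈S e =
      f-coloring (owner x) (owner y)
        (subst₂ (λ x y → H ⟨ x ~ y ⟩) (toWitness x∈S) (toWitness y∈S) e)

    S-transversal : ∀ v → ∃! _≡_ (λ x → x ∈ L v × x ∈ S)
    S-transversal v = color v (f v) ,
      (color∈L v _ , fromWitness (cong (λ u → color u (f u)) (sym (owner-unique (color∈L v _))))) ,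
      λ {y} → λ (y∈Lv , y∈S) → sym (trans (toWitness y∈S)
        (cong (λ u → color u (f u)) (owner-unique y∈Lv)))

  aligned⇒canonical : Aligned → Canonical q
  aligned⇒canonical (col , col-injective , col-M) = label , label-bijective , label-adjacent
    where
    uncol : ∀ v i → ∃[ c ] col v c ≡ i
    uncol v = injective⇒surjective (col v) (col-injective v)

    label-at : ∀ v {x} → x ∈ L v → Fin q
    label-at v x∈Lv = proj₁ (uncol v (index v x∈Lv))

    label : V H → Fin q
    label x = label-at (owner x) (proj₂ (union x))

    -- `label` reads off the owner and membership proof supplied by `union`. Lists are disjoint and
    -- membership is proof-irrelevant, so any other proof gives the same label.
    label≡label-at : ∀ {x v} (x∈Lv : x ∈ L v) → label x ≡ label-at v x∈Lv
    label≡label-at {x} {v} x∈Lv = go (owner-unique x∈Lv) (proj₂ (union x)) x∈Lv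
      where
      go : ∀ {u v} → u ≡ v → (p : x ∈ L u) (p′ : x ∈ L v) → label-at u p ≡ label-at v p′
      go {u} refl p p′ = cong (label-at u) (T-irrelevant p p′)

    color-label : ∀ {x v} → x ∈ L v → color v (col v (label x)) ≡ x
    color-label {x} {v} x∈Lv =
      trans (cong (color v ∘ col v) (label≡label-at x∈Lv))
            (trans (cong (color v) (proj₂ (uncol v (index v x∈Lv)))) (color-index v x∈Lv))

    label-color : ∀ v c → label (color v (col v c)) ≡ c
    label-color v c = col-injective v (color-injective v (color-label (color∈L v _)))

    label-bijective : ∀ v → Bijective {A = Elem (L v)} _≡_ _≡_ (label ∘ proj₁)
    label-bijective v =
      (λ {(x , x∈Lv)} {(y , y∈Lv)} p → Elem-≡ (L v)
        (trans (sym (color-label x∈Lv)) (trans (cong (color v ∘ col v) p) (color-label y∈Lv)))) ,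
      λ c → (color v (col v c) , color∈L v _) , λ { refl → label-color v c }

    label-adjacent : ∀ {u v} → G ⟨ u ~ v ⟩ → ∀ {x y} → x ∈ L u → y ∈ L v →
      (H ⟨ x ~ y ⟩ → label x ≡ label y) × (label x ≡ label y → H ⟨ x ~ y ⟩)
    label-adjacent {u} {v} u~v {x} {y} x∈Lu y∈Lv =
      (λ e → col-injective v (DPCover.M-functional numbered (col-M u~v (label x))
        (subst₂ (λ x y → H ⟨ x ~ y ⟩) (sym (color-label x∈Lu)) (sym (color-label y∈Lv)) e))) ,
      λ p → subst₂ (λ x y → H ⟨ x ~ y ⟩) (color-label x∈Lu)
              (trans (cong (color v ∘ col v) p) (color-label y∈Lv)) (col-M u~v (label x))

module _ {G : Graph} {q : ℕ} (D : DPCover G q) where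
  open DPCover D
  private
    _≟ⱽ_ = vertex-≟ G

  cover : Cover G
  cover = record
    { H = record
      { V        = V G × Fin q
      ; V-finite = _ , ↔-trans (proj₂ (Graph.V-finite G) ×-↔ ↔-refl) (↔-sym *↔×)
      ; _~_      = λ (u , i) (v , j) → M u v i j
      ; _~?_     = λ (u , i) (v , j) → M? u v i j
      ; ~-sym    = M-sym
      ; ~-irrefl = λ { refl m → Graph.~-irrefl G refl (M-edge m) }
      }
    ; L           = λ v (u , _) → isYes (u ≟ⱽ v)
    ; disjoint    = λ u≢v _ (p , p′) → u≢v (trans (sym (toWitness p)) (toWitness p′))
    ; independent = λ v p p′ m →
        Graph.~-irrefl G (trans (toWitness p) (sym (toWitness p′))) (M-edge m)
    ; union       = λ (v , _) → v , fromWitness refl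
    ; between     = λ {u} {v} _ (_ , _ , p , p′ , m) →
        subst₂ (G ⟨_~_⟩) (toWitness p) (toWitness p′) (M-edge m) ,
        (λ { {_ , i} (_ , p , m) (_ , p′ , m′) → functional i (toWitness p) (toWitness p′) m m′ }) ,
        (λ { {y = _ , j} (p , _ , m) (p′ , _ , m′) →
          functional j (toWitness p) (toWitness p′) (M-sym m) (M-sym m′) })
    }
    where
    functional : ∀ {u v v′ w j j′} i → v ≡ w → v′ ≡ w → M u v i j → M u v′ i j′ →
      (v , j) ≡ (v′ , j′)
    functional _ refl refl m m′ = cong (_ ,_) (M-functional m m′)

  open Cover cover

  cover-fold : Fold q
  cover-fold v = mk↔ₛ′ (proj₂ ∘ proj₁) (λ i → (v , i) , fromWitness refl) (λ _ → refl)
    λ ((u , i) , p) → Elem-≡ (L v) (cong (_, i) (sym (toWitness p)))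

  uncolorable⇒bad : Uncolorable → Bad
  uncolorable⇒bad unc (S , S-independent , S-transversal) = unc (f , f-coloring)
    where
    f : V G → Fin q
    f v = proj₂ (proj₁ (S-transversal v))

    f∈S : ∀ v → (v , f v) ∈ S
    f∈S v with S-transversal v
    ... | (u , i) , (p , x∈S) , _ = subst (λ u → (u , i) ∈ S) (toWitness p) x∈S

    f-coloring : IsColoring f
    f-coloring u v m = S-independent (f∈S u) (f∈S v) m

  canonical⇒aligned : Canonical q → Aligned
  canonical⇒aligned (label , label-bijective , label-adjacent) =
    col ,
    (λ v {c} {c′} p →
      trans (sym (label-col v c)) (trans (cong (label ∘ (v ,_)) p) (label-col v c′))) ,
    λ {u} {v} u~v c → proj₂ (label-adjacent u~v (fromWitness refl) (fromWitness refl))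
      (trans (label-col u c) (sym (label-col v c)))
    where
    preimage : ∀ v c → ∃[ i ] label (v , i) ≡ c
    preimage v c with proj₂ (label-bijective v) c
    ... | ((u , i) , p) , h = i , trans (cong (λ u → label (u , i)) (sym (toWitness p))) (h refl)

    col : V G → Fin q → Fin q
    col v c = proj₁ (preimage v c)

    label-col : ∀ v c → label (v , col v c) ≡ c
    label-col v c = proj₂ (preimage v c)

robust⇒robustly-critical : ∀ {q G} → Robust q G → RobustlyKCritical (suc q) G
robust⇒robustly-critical R = robust⇒critical R , λ C fold bad →
  aligned⇒canonical C fold (Robust.aligned R (numbered C fold) (bad⇒uncolorable C fold bad))

robustly-critical⇒robust : ∀ {q G} → RobustlyKCritical (suc q) G → Robust q G
robustly-critical⇒robust {q} {G} (critical , canonical) = record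
  { uncolorable   = critical⇒uncolorable {G = G} critical
  ; delete-vertex = critical⇒delete-vertex critical
  ; aligned       = λ D unc →
      canonical⇒aligned D (canonical (cover D) (cover-fold D) (uncolorable⇒bad D unc))
  }

-- Joins with complete graphs

record GraphIso (G G′ : Graph) : Set where
  field
    to       : V G → V G′
    from     : V G′ → V G
    to-from  : ∀ v → to (from v) ≡ v
    from-to  : ∀ v → from (to v) ≡ v
    to-adj   : ∀ {u v} → G ⟨ u ~ v ⟩ → G′ ⟨ to u ~ to v ⟩
    from-adj : ∀ {u v} → G′ ⟨ u ~ v ⟩ → G ⟨ from u ~ from v ⟩

module _ {G G′ : Graph} (iso : GraphIso G G′) {q : ℕ} where
  open GraphIso iso

  module _ (D : DPCover G′ q) where
    open DPCover D

    pullback : DPCover G q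
    pullback = record
      { M            = λ u v → M (to u) (to v)
      ; M?           = λ u v → M? (to u) (to v)
      ; M-sym        = M-sym
      ; M-functional = M-functional
      ; M-edge       = λ m → subst₂ (G ⟨_~_⟩) (from-to _) (from-to _) (from-adj (M-edge m))
      }

    pullback-uncolorable : Uncolorable → DPCover.Uncolorable pullback
    pullback-uncolorable unc (f , f-coloring) = unc (f ∘ from , λ u v m →
      f-coloring (from u) (from v)
        (subst₂ (λ x y → M x y (f (from u)) (f (from v))) (sym (to-from u)) (sym (to-from v)) m))

    pullback-aligned : DPCover.Aligned pullback → Aligned
    pullback-aligned (col , col-injective , col-M) =
      col ∘ from , col-injective ∘ from , λ {u} {v} u~v c →
        subst₂ (λ x y → M x y (col (from u) c) (col (from v) c)) (to-from u) (to-from v)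
          (col-M (from-adj u~v) c)

  robust-iso : Robust q G → Robust q G′
  robust-iso R = record
    { uncolorable   = λ (c , h) → uncolorable (c ∘ to , λ e → h (to-adj e))
    ; delete-vertex = λ w → let c , h , c-zero = delete-vertex (from w) in
        c ∘ from , (λ e → h (from-adj e)) ,
        λ v p → trans (sym (to-from v)) (trans (cong to (c-zero (from v) p)) (to-from w))
    ; aligned       = λ D unc →
        pullback-aligned D (aligned (pullback D) (pullback-uncolorable D unc))
    }
    where open Robust R

join-empty : ∀ G → GraphIso G (G ∨ complete 0)
join-empty G = record
  { to       = inj₁
  ; from     = λ { (inj₁ v) → v }
  ; to-from  = λ { (inj₁ _) → refl }
  ; from-to  = λ _ → refl
  ; to-adj   = λ e → e
  ; from-adj = λ { {inj₁ _} {inj₁ _} e → e }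
  }

-- Lets the clique be added one vertex at a time: the new apex becomes `zero` and the old clique
-- shifts up by one.
join-suc : ∀ G t → GraphIso ((G ∨ complete t) ∨ complete 1) (G ∨ complete (suc t))
join-suc G t = record
  { to       = to
  ; from     = from
  ; to-from  = λ { (inj₁ _) → refl ; (inj₂ zero) → refl ; (inj₂ (suc _)) → refl }
  ; from-to  = λ { (inj₁ (inj₁ _)) → refl ; (inj₁ (inj₂ _)) → refl ; (inj₂ zero) → refl }
  ; to-adj   = λ {u} {v} → to-adj u v
  ; from-adj = λ {u} {v} → from-adj u v
  }
  where
  Cone = (G ∨ complete t) ∨ complete 1
  Join = G ∨ complete (suc t)

  to : V Cone → V Join
  to (inj₁ (inj₁ v)) = inj₁ v
  to (inj₁ (inj₂ i)) = inj₂ (suc i)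
  to (inj₂ _)        = inj₂ zero

  from : V Join → V Cone
  from (inj₁ v)       = inj₁ (inj₁ v)
  from (inj₂ zero)    = inj₂ zero
  from (inj₂ (suc i)) = inj₁ (inj₂ i)

  to-adj : ∀ u v → Cone ⟨ u ~ v ⟩ → Join ⟨ to u ~ to v ⟩
  to-adj (inj₁ (inj₁ _)) (inj₁ (inj₁ _)) e = e
  to-adj (inj₁ (inj₁ _)) (inj₁ (inj₂ _)) e = e
  to-adj (inj₁ (inj₁ _)) (inj₂ _)        e = e
  to-adj (inj₁ (inj₂ _)) (inj₁ (inj₁ _)) e = e
  to-adj (inj₁ (inj₂ _)) (inj₁ (inj₂ _)) e = e ∘ suc-injective
  to-adj (inj₁ (inj₂ _)) (inj₂ _)        e = λ ()
  to-adj (inj₂ _)        (inj₁ (inj₁ _)) e = e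
  to-adj (inj₂ _)        (inj₁ (inj₂ _)) e = λ ()
  to-adj (inj₂ zero)     (inj₂ zero)     e = λ _ → e refl

  from-adj : ∀ u v → Join ⟨ u ~ v ⟩ → Cone ⟨ from u ~ from v ⟩
  from-adj (inj₁ _)       (inj₁ _)       e = e
  from-adj (inj₁ _)       (inj₂ zero)    e = e
  from-adj (inj₁ _)       (inj₂ (suc _)) e = e
  from-adj (inj₂ zero)    (inj₁ _)       e = e
  from-adj (inj₂ (suc _)) (inj₁ _)       e = e
  from-adj (inj₂ zero)    (inj₂ zero)    e = λ _ → e refl
  from-adj (inj₂ zero)    (inj₂ (suc _)) e = tt
  from-adj (inj₂ (suc _)) (inj₂ zero)    e = tt
  from-adj (inj₂ (suc _)) (inj₂ (suc _)) e = e ∘ cong suc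

-- Adding one dominating vertex

other : ∀ {n} → 2 ≤ n → (i : Fin n) → ∃[ j ] j ≢ i
other (s≤s (s≤s _)) i = punchIn i zero , punchInᵢ≢i i zero

module _ {q : ℕ} {G : Graph} (R : Robust q G) where
  open Robust R

  -- On an isolated `v` the reserved color could be replaced by `i`, which would color `G` with `q`
  -- colors.
  robust-neighbor : Fin q → ∀ v → ∃[ u ] G ⟨ v ~ u ⟩
  robust-neighbor i v with finite-any? (Graph.V-finite G) (Graph._~?_ G v)
  ... | yes n = n
  ... | no isolated = contradiction (c′ , λ {u} {w} → c′-proper u w) uncolorable
    where
    c = proj₁ (delete-vertex v)
    c-proper = proj₁ (proj₂ (delete-vertex v))
    c-zero = proj₂ (proj₂ (delete-vertex v))

    recolor : Fin (suc q) → Fin q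
    recolor zero    = i
    recolor (suc j) = j

    recolor-injective : ∀ x y → x ≢ zero → y ≢ zero → recolor x ≡ recolor y → x ≡ y
    recolor-injective zero    _       x≢0 _   _    = contradiction refl x≢0
    recolor-injective (suc _) zero    _   y≢0 _    = contradiction refl y≢0
    recolor-injective (suc _) (suc _) _   _   refl = refl

    c′ : V G → Fin q
    c′ = recolor ∘ c

    c′-proper : ∀ u w → G ⟨ u ~ w ⟩ → c′ u ≢ c′ w
    c′-proper u w e p = c-proper e (recolor-injective (c u) (c w)
      (λ z → isolated (w , subst (λ x → G ⟨ x ~ w ⟩) (c-zero u z) e))
      (λ z → isolated (u , subst (λ x → G ⟨ x ~ u ⟩) (c-zero w z) (Graph.~-sym G e))) p)

  private
    Cone = G ∨ complete 1
    apex : V Cone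
    apex = inj₂ zero

  cone-uncolorable : ¬ Colorable Cone (suc q)
  cone-uncolorable (c , h) = uncolorable
    ( (λ v → punchOut (c≢ v))
    , λ {u} {v} e p → h {inj₁ u} {inj₁ v} e (punchOut-injective (c≢ u) (c≢ v) p))
    where
    c≢ : ∀ v → c apex ≢ c (inj₁ v)
    c≢ v = h {apex} {inj₁ v} tt

  cone-delete-vertex : ∀ w → ColorableWithout Cone (suc q) w
  cone-delete-vertex (inj₁ w) = c′ , (λ {u} {v} → c′-proper u v) , c′-zero
    where
    c = proj₁ (delete-vertex w)

    c′ : V Cone → Fin (suc (suc q))
    -- Skipping color one frees it for the apex and leaves zero in place, still reserved for `w`.
    c′ (inj₁ v) = punchIn (suc zero) (c v)
    c′ (inj₂ _) = suc zero

    c′-proper : ∀ u v → Cone ⟨ u ~ v ⟩ → c′ u ≢ c′ v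
    c′-proper (inj₁ u) (inj₁ v) e p =
      proj₁ (proj₂ (delete-vertex w)) e (punchIn-injective (suc zero) _ _ p)
    c′-proper (inj₁ u) (inj₂ _) _ p = punchInᵢ≢i (suc zero) (c u) p
    c′-proper (inj₂ _) (inj₁ v) _ p = punchInᵢ≢i (suc zero) (c v) (sym p)
    c′-proper (inj₂ zero) (inj₂ zero) e _ = e refl

    c′-zero : ∀ v → c′ v ≡ zero → v ≡ inj₁ w
    c′-zero (inj₁ v) p =
      cong inj₁ (proj₂ (proj₂ (delete-vertex w)) v (punchIn-injective (suc zero) _ zero p))
  cone-delete-vertex (inj₂ zero) = c′ , (λ {u} {v} → c′-proper u v) , c′-zero
    where
    G-colorable : Colorable G (suc q)
    G-colorable = proj₁ (proj₁ (robust⇒critical R))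

    c′ : V Cone → Fin (suc (suc q))
    c′ (inj₁ v) = suc (proj₁ G-colorable v)
    c′ (inj₂ _) = zero

    c′-proper : ∀ u v → Cone ⟨ u ~ v ⟩ → c′ u ≢ c′ v
    c′-proper (inj₁ _) (inj₁ _) e p = proj₂ G-colorable e (suc-injective p)
    c′-proper (inj₁ _) (inj₂ _) _ ()
    c′-proper (inj₂ _) (inj₁ _) _ ()
    c′-proper (inj₂ zero) (inj₂ zero) e _ = e refl

    c′-zero : ∀ v → c′ v ≡ zero → v ≡ apex
    c′-zero (inj₂ zero) _ = refl

  module _ (D : DPCover Cone (suc q)) (unc : DPCover.Uncolorable D) where
    open DPCover D

    -- The cover of `G` left when color `p v` is deleted at every `v`, with the surviving colors
    -- renumbered through `punchIn`.
    remove : (V G → Fin (suc q)) → DPCover G q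
    remove p = record
      { M            = λ u v i j → M (inj₁ u) (inj₁ v) (punchIn (p u) i) (punchIn (p v) j)
      ; M?           = λ u v i j → M? (inj₁ u) (inj₁ v) (punchIn (p u) i) (punchIn (p v) j)
      ; M-sym        = M-sym
      ; M-functional = λ {_} {v} m m′ → punchIn-injective (p v) _ _ (M-functional m m′)
      ; M-edge       = M-edge
      }

    -- Coloring the apex with c only forbids the removed colors.
    Removes : Fin (suc q) → (V G → Fin (suc q)) → Set
    Removes c p = ∀ {v j} → M apex (inj₁ v) c j → j ≡ p v

    remove-uncolorable : ∀ {c p} → Removes c p → DPCover.Uncolorable (remove p)
    remove-uncolorable {c} {p} removes (f , f-coloring) = unc (f′ , f′-coloring)
      where
      f′ : V Cone → Fin (suc q)
      f′ (inj₁ v) = punchIn (p v) (f v)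
      f′ (inj₂ _) = c

      f′-coloring : IsColoring f′
      f′-coloring (inj₁ u)    (inj₁ v)    m = f-coloring u v m
      f′-coloring (inj₁ u)    (inj₂ zero) m = punchInᵢ≢i (p u) (f u) (removes (M-sym m))
      f′-coloring (inj₂ zero) (inj₁ v)    m = punchInᵢ≢i (p v) (f v) (removes m)
      f′-coloring (inj₂ zero) (inj₂ zero) m = M-edge m refl

    -- The cover left after the removal is bad, hence aligned and perfect; `i` survives at `u`
    -- because it is not the removed color.
    remove-perfect : ∀ {c p} → Removes c p → ∀ {u v} → G ⟨ u ~ v ⟩ → ∀ {i} → p u ≢ i →
      ∃[ j ] (j ≢ p v × M (inj₁ u) (inj₁ v) i j)
    remove-perfect {c} {p} removes {u} {v} u~v {i} pu≢i
      with j , m ← DPCover.aligned⇒perfect (remove p)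
                     (aligned (remove p) (remove-uncolorable removes)) u~v (punchOut pu≢i)
      = punchIn (p v) j , punchInᵢ≢i (p v) j ,
        subst (λ i → M (inj₁ u) (inj₁ v) i (punchIn (p v) j)) (punchIn-punchOut pu≢i) m

    apex-removal : ∀ c v → Fin (suc q)
    apex-removal c v with any? (M? apex (inj₁ v) c)
    ... | yes (j , _) = j
    -- Here `c` forbids nothing at `v`; an arbitrary color is removed so that exactly `q` remain.
    ... | no _        = zero

    apex-removal-removes : ∀ c → Removes c (apex-removal c)
    apex-removal-removes c {v} m with any? (M? apex (inj₁ v) c)
    ... | yes (_ , m′) = M-functional m m′
    ... | no none      = contradiction (_ , m) none

robust-zero-unique : ∀ {G} → Robust 0 G → ∀ u v → u ≡ v
robust-zero-unique R u v =
  let c , _ , c-zero = Robust.delete-vertex R v in c-zero u (fin-one-unique (c u))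

-- If c had no neighbor among the colors of v, then any color of v
-- could be removed in its stead, and so all q + 1 colors of v would be
-- matched into the q remaining colors of a neighbor of v.
apex-perfect : ∀ {q G} → Robust q G → (D : DPCover (G ∨ complete 1) (suc q)) →
  DPCover.Uncolorable D → ∀ c v → ∃[ j ] DPCover.M D (inj₂ zero) (inj₁ v) c j
apex-perfect {zero} {G} R D unc c v =
  decidable-stable (any? (M? (inj₂ zero) (inj₁ v) c)) λ none →
    -- For q = 0 the graph `G` is the single vertex `v`, so the only possible conflict is between
    -- `v` and the apex, which `none` excludes.
    let f-coloring : IsColoring (λ _ → c)
        f-coloring = λ
          { (inj₁ u)    (inj₁ w)    m → Graph.~-irrefl G (robust-zero-unique R u w) (M-edge m)
          ; (inj₁ u)    (inj₂ zero) m → none (c , M-sym (subst-M u m))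
          ; (inj₂ zero) (inj₁ w)    m → none (c , M-sym (subst-M w (M-sym m)))
          ; (inj₂ zero) (inj₂ zero) m → M-edge m refl
          }
    in unc (_ , f-coloring)
  where
  open DPCover D
  subst-M : ∀ u {i j} → M (inj₁ u) (inj₂ zero) i j → M (inj₁ v) (inj₂ zero) i j
  subst-M u {i} {j} = subst (λ u → M (inj₁ u) (inj₂ zero) i j) (robust-zero-unique R u v)
apex-perfect {suc q} {G} R D unc c v =
  decidable-stable (any? (M? (inj₂ zero) (inj₁ v) c)) λ none →
    contradiction (injective⇒≤ {f = f none} (f-injective none)) 1+n≰n
  where
  open DPCover D
  _≟ⱽ_ = vertex-≟ G

  u = proj₁ (robust-neighbor R zero v)
  v~u = proj₂ (robust-neighbor R zero v)

  r = apex-removal R D unc c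

  removal : Fin (suc (suc q)) → V G → Fin (suc (suc q))
  removal i w with w ≟ⱽ v
  ... | yes _ = i
  ... | no _  = r w

  removal-v : ∀ i → removal i v ≡ i
  removal-v i with v ≟ⱽ v
  ... | yes _  = refl
  ... | no v≢v = contradiction refl v≢v

  removal-u : ∀ i → removal i u ≡ r u
  removal-u i with u ≟ⱽ v
  ... | yes u≡v = contradiction v~u (Graph.~-irrefl G (sym u≡v))
  ... | no _    = refl

  None : Set
  None = ¬ ∃ (M (inj₂ zero) (inj₁ v) c)

  removal-removes : None → ∀ i → Removes R D unc c (removal i)
  removal-removes none i {w} m with w ≟ⱽ v
  ... | yes refl = contradiction (_ , m) none
  ... | no _     = apex-removal-removes R D unc c m

  match : None → ∀ i → ∃[ j ] (r u ≢ j × M (inj₁ v) (inj₁ u) i j)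
  match none i =
    -- Removing another color `i′` at `v` keeps `i` alive, while the color removed at `u` remains
    -- `r u`.
    let i′ , i′≢i = other (s≤s (s≤s z≤n)) i
        j , j≢ , m = remove-perfect R D unc (removal-removes none i′) v~u
                       (λ p → i′≢i (trans (sym (removal-v i′)) p))
    in j , (λ p → j≢ (trans (sym p) (sym (removal-u i′)))) , m

  f : None → Fin (suc (suc q)) → Fin (suc q)
  f none i = punchOut (proj₁ (proj₂ (match none i)))

  f-injective : (none : None) → Injective _≡_ _≡_ (f none)
  f-injective none {i} {i′} p =
    let j , j≢ , m = match none i
        j′ , j′≢ , m′ = match none i′
    in M-injective m (subst (M _ _ i′) (sym (punchOut-injective j≢ j′≢ p)) m′)

inhabited : ∀ {n} → Fin n → 1 ≤ n
inhabited zero    = s≤s z≤n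
inhabited (suc _) = s≤s z≤n

module _ {q : ℕ} {G : Graph} (R : Robust q G)
  (D : DPCover (G ∨ complete 1) (suc q)) (unc : DPCover.Uncolorable D) where
  open DPCover D

  private
    N : V G → Fin (suc q) → Fin (suc q)
    N v c = proj₁ (apex-perfect R D unc c v)

    N-M : ∀ v c → M (inj₂ zero) (inj₁ v) c (N v c)
    N-M v c = proj₂ (apex-perfect R D unc c v)

    N-injective : ∀ v → Injective _≡_ _≡_ (N v)
    N-injective v {c} {c′} p = M-injective (N-M v c) (subst (M _ _ c′) (sym p) (N-M v c′))

    rematch : ∀ {u v c i} → G ⟨ u ~ v ⟩ → N u c ≢ i → ∃[ j ] (j ≢ N v c × M (inj₁ u) (inj₁ v) i j)
    rematch {c = c} u~v =
      remove-perfect R D unc {c} {λ v → N v c} (λ m → M-functional m (N-M _ c)) u~v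

    -- Color the apex with some `c′` other than `c`: then `N u c` survives and is matched to some
    -- `N v c″`. If `c″` were not `c`, coloring the apex with `c″` would match `N u c` to a color
    -- other than `N v c″`, against functionality.
    N-aligned : ∀ {u v} → G ⟨ u ~ v ⟩ → ∀ c → M (inj₁ u) (inj₁ v) (N u c) (N v c)
    N-aligned {u} {v} u~v c
      with c′ , c′≢c ← other (s≤s (inhabited (robust-color R u~v))) c
      with j , _ , m ← rematch {c = c′} u~v (c′≢c ∘ N-injective u)
      with c″ , refl ← injective⇒surjective (N v) (N-injective v) j
      with c″ ≟ c
    ... | yes refl = m
    ... | no c″≢c  =
      let j′ , j′≢ , m′ = rematch {c = c″} u~v (c″≢c ∘ N-injective u)
      in contradiction (M-functional m′ m) j′≢

  cone-aligned : Aligned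
  cone-aligned = col , col-injective , λ {u} {v} → col-M u v
    where
    col : V (G ∨ complete 1) → Fin (suc q) → Fin (suc q)
    col (inj₁ v) = N v
    col (inj₂ _) c = c

    col-injective : ∀ v → Injective _≡_ _≡_ (col v)
    col-injective (inj₁ v) = N-injective v
    col-injective (inj₂ _) p = p

    col-M : ∀ u v → (G ∨ complete 1) ⟨ u ~ v ⟩ → ∀ c → M u v (col u c) (col v c)
    col-M (inj₁ u)    (inj₁ v)    e c = N-aligned e c
    col-M (inj₁ u)    (inj₂ zero) _ c = M-sym (N-M u c)
    col-M (inj₂ zero) (inj₁ v)    _ c = N-M v c
    col-M (inj₂ zero) (inj₂ zero) e c = contradiction refl e

robust-cone : ∀ {q G} → Robust q G → Robust (suc q) (G ∨ complete 1)
robust-cone R = record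
  { uncolorable   = cone-uncolorable R
  ; delete-vertex = cone-delete-vertex R
  ; aligned       = cone-aligned R
  }

robust-join : ∀ {q G} → Robust q G → ∀ t → Robust (t + q) (G ∨ complete t)
robust-join {G = G} R zero    = robust-iso (join-empty G) R
robust-join {G = G} R (suc t) = robust-iso (join-suc G t) (robust-cone (robust-join R t))

robustly-critical-join : ∀ G → RobustlyCritical G → ∀ t → RobustlyCritical (G ∨ complete t)
robustly-critical-join G (suc q , _ , R) t =
  suc (t + q) , s≤s z≤n ,
  robust⇒robustly-critical (robust-join (robustly-critical⇒robust {G = G} R) t)

-- Greedy coloring

module Greedy {G : Graph} {q : ℕ} (D : DPCover G q) where
  open DPCover D

  Partial : Set
  Partial = List (V G × Fin q)

  Proper : Partial → Set
  Proper = AllPairs λ (v , i) (u , j) → u ≢ v × ¬ M u v j i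

  Free : Partial → V G → Fin q → Set
  Free σ v i = All (λ (u , j) → ¬ M u v j i) σ

  Uncolored : Partial → V G → Set
  Uncolored σ v = ∀ {j} → (v , j) ∉ˡ σ

  proper-functional : ∀ {σ v i j} → Proper σ → (v , i) ∈ˡ σ → (v , j) ∈ˡ σ → i ≡ j
  proper-functional (_ ∷ _) (here refl) (here refl) = refl
  proper-functional (p ∷ _) (here refl) (there m)   = contradiction refl (proj₁ (All.lookup p m))
  proper-functional (p ∷ _) (there m)   (here refl) = contradiction refl (proj₁ (All.lookup p m))
  proper-functional (_ ∷ p) (there m)   (there m′)  = proper-functional p m m′

  proper-¬M : ∀ {σ u v i j} → Proper σ → (u , i) ∈ˡ σ → (v , j) ∈ˡ σ → ¬ M u v i j
  proper-¬M (_ ∷ _) (here refl) (here refl) m = Graph.~-irrefl G refl (M-edge m)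
  proper-¬M (p ∷ _) (here refl) (there v∈)  m = proj₂ (All.lookup p v∈) (M-sym m)
  proper-¬M (p ∷ _) (there u∈)  (here refl) m = proj₂ (All.lookup p u∈) m
  proper-¬M (_ ∷ p) (there u∈)  (there v∈)  m = proper-¬M p u∈ v∈ m

  proper-∷ : ∀ {σ v i} → Proper σ → Uncolored σ v → Free σ v i → Proper ((v , i) ∷ σ)
  proper-∷ p v∉σ free =
    All.tabulate (λ u∈ → (λ { refl → v∉σ u∈ }) , All.lookup free u∈) ∷ p

  -- Together, the two colored vertices forbid at most one color of v.
  Agree : V G → V G × Fin q → V G × Fin q → Set
  Agree v (u , i) (u′ , i′) = ∀ {e e′} → M u v i e → M u′ v i′ e′ → e ≡ e′

  agree-sym : ∀ {v s t} → Agree v s t → Agree v t s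
  agree-sym agree m m′ = sym (agree m′ m)

  -- Counting: if every color of `v` had a partner at `u`, the partners would be distinct and
  -- exhaust the colors of `u`, including `i`.
  unmatched : ∀ {u v} i → ¬ ∃ (M u v i) → ∃[ j ] ¬ ∃ (λ i → M u v i j)
  unmatched {u} {v} i none = decidable-stable
    (any? λ j → ¬? (any? λ i → M? u v i j)) λ all-matched →
      let match : ∀ j → ∃ λ i → M u v i j
          match j = decidable-stable (any? λ i → M? u v i j) λ n → all-matched (j , n)
          j , p = injective⇒surjective (proj₁ ∘ match)
            (λ {j} {j′} p → M-functional (proj₂ (match j))
               (subst (λ i → M u v i j′) (sym p) (proj₂ (match j′)))) i
      in none (j , subst (λ i → M u v i j) p (proj₂ (match j)))

  -- If `i` forbids nothing at `v`, any color of `w` will do. If it forbids `e`, take the partner of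
  -- `e` at `w`; if there is none, some color of `w` has no partner at `v` and agrees vacuously.
  agreeing-color : ∀ u v w i → ∃[ j ] Agree v (u , i) (w , j)
  agreeing-color u v w i with any? (M? u v i)
  ... | no none = i , λ m _ → contradiction (_ , m) none
  ... | yes (e , m) with any? (M? v w e)
  ...   | yes (j , m′) = j , λ m₁ m₂ →
    trans (M-functional m₁ m) (M-functional (M-sym m′) m₂)
  ...   | no none =
    let j , none′ = unmatched e none in j , λ _ m′ → contradiction (_ , M-sym m′) none′

  -- `N` is a set of slots, at most `q` of them by `ι`, that together hold every colored neighbor of
  -- `v`.
  module _ {σ} (proper : Proper σ) (v : V G) {N : Set}
    (ι : N → Fin q) (ι-injective : Injective _≡_ _≡_ ι)
    (neighbor : N → V G)
    (covers : ∀ {u j} → (u , j) ∈ˡ σ → G ⟨ u ~ v ⟩ → ∃[ n ] neighbor n ≡ u) where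

    private
      Forbids : N → Fin q → Set
      Forbids n e = ∃[ j ] ((neighbor n , j) ∈ˡ σ × M (neighbor n) v j e)

      forbids-functional : ∀ {n e e′} → Forbids n e → Forbids n e′ → e ≡ e′
      forbids-functional (_ , p , m) (_ , p′ , m′) with refl ← proper-functional proper p p′ =
        M-functional m m′

      free? : Dec (∃ (Free σ v))
      free? = any? λ e → All.all? (λ (u , j) → ¬? (M? u v j e)) σ

      forbidden : ¬ ∃ (Free σ v) → ∀ e → ∃[ n ] Forbids n e
      forbidden none e with Any.any? (λ (u , j) → M? u v j e) σ
      ... | no ¬any = contradiction (e , ¬Any⇒All¬ σ ¬any) none
      ... | yes any with (u , j) , u∈σ , m ← find any
                    with n , refl ← covers u∈σ (M-edge m) = n , j , u∈σ , m

      -- Each slot forbids at most one color. If all `q` colors are forbidden, their forbidding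
      -- slots are distinct, and since there are at most `q` slots, every slot is used.
      forbids-one : (none : ¬ ∃ (Free σ v)) → ∀ n → ∃[ e ] proj₁ (forbidden none e) ≡ n
      forbids-one none n =
        let e , p = injective⇒surjective (ι ∘ forbidder) (forbidder-injective ∘ ι-injective) (ι n)
        in e , ι-injective p
        where
        forbidder : Fin q → N
        forbidder e = proj₁ (forbidden none e)

        forbidder-injective : Injective _≡_ _≡_ forbidder
        forbidder-injective {e} {e′} p = forbids-functional
          (proj₂ (forbidden none e))
          (subst (λ n → Forbids n e′) (sym p) (proj₂ (forbidden none e′)))

    free-if-idle : ∀ n → Uncolored σ (neighbor n) → ∃ (Free σ v)
    free-if-idle n idle = decidable-stable free? λ none →
      let e , p = forbids-one none n
          j , n∈σ , _ = proj₂ (forbidden none e)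
      in idle (subst (λ n → (neighbor n , j) ∈ˡ σ) p n∈σ)

    -- With no free color, the slots of `u` and `u′` each forbid a color. Agreement makes it the
    -- same color, which has only one recorded forbidder, so `u` and `u′` would coincide.
    free-if-agree : ∀ {u i u′ i′} → (u , i) ∈ˡ σ → (u′ , i′) ∈ˡ σ → u ≢ u′ →
      G ⟨ u ~ v ⟩ → G ⟨ u′ ~ v ⟩ → Agree v (u , i) (u′ , i′) → ∃ (Free σ v)
    free-if-agree {u} {i} {u′} {i′} u∈σ u′∈σ u≢u′ u~v u′~v agree = decidable-stable free? λ none →
      let e , p , m = forbids none u∈σ u~v
          e′ , p′ , m′ = forbids none u′∈σ u′~v
      in u≢u′ (trans (sym p) (trans
           (cong (λ e → neighbor (proj₁ (forbidden none e))) (agree m m′)) p′))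
      where
      forbids : (none : ¬ ∃ (Free σ v)) → ∀ {u i} → (u , i) ∈ˡ σ → G ⟨ u ~ v ⟩ →
        ∃[ e ] (neighbor (proj₁ (forbidden none e)) ≡ u × M u v i e)
      forbids none u∈σ u~v =
        let n , n≡u = covers u∈σ u~v
            e , p = forbids-one none n
            _ , n∈σ , m = proj₂ (forbidden none e)
            w≡u = trans (cong neighbor p) n≡u
        in e , w≡u , transport w≡u n∈σ u∈σ m
        where
        transport : ∀ {w u j i e} → w ≡ u → (w , j) ∈ˡ σ → (u , i) ∈ˡ σ → M w v j e → M u v i e
        transport refl w∈σ u∈σ m with refl ← proper-functional proper w∈σ u∈σ = m

  -- Greedy coloring by increasing rank, starting from `σ₀`. The predicate `Early` allows the
  -- vertices of `σ₀` to be colored ahead of their rank.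
  module _ {σ₀ : Partial} (σ₀-proper : Proper σ₀) (Early : V G → Set)
    (σ₀-early : ∀ {u j} → (u , j) ∈ˡ σ₀ → Early u)
    (rank : V G → ℕ) (bound : ℕ) (rank<bound : ∀ v → rank v < bound)
    (free : ∀ {σ} v → Proper σ → (∀ {s} → s ∈ˡ σ₀ → s ∈ˡ σ) →
      (∀ {u j} → (u , j) ∈ˡ σ → Early u ⊎ rank u ≤ rank v) → Uncolored σ v → ∃ (Free σ v)) where

    private
      record Stage (n : ℕ) (σ : Partial) : Set where
        field
          proper  : Proper σ
          extends : ∀ {s} → s ∈ˡ σ₀ → s ∈ˡ σ
          early   : ∀ {u j} → (u , j) ∈ˡ σ → Early u ⊎ rank u < n

      open Stage

      Colored : Partial → V G → Set
      Colored σ v = ∃[ i ] (v , i) ∈ˡ σ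

      colored? : ∀ σ v → Dec (Colored σ v)
      colored? σ v with Any.any? (λ (u , _) → vertex-≟ G u v) σ
      ... | yes any with (u , i) , u∈σ , refl ← find any = yes (i , u∈σ)
      ... | no ¬any = no λ (i , v∈σ) → All.lookup (¬Any⇒All¬ σ ¬any) v∈σ refl

      color-vertex : ∀ {σ} v → Stage (suc (rank v)) σ →
        ∃[ σ′ ] (Stage (suc (rank v)) σ′ × (∀ {s} → s ∈ˡ σ → s ∈ˡ σ′) × Colored σ′ v)
      color-vertex {σ} v st with colored? σ v
      ... | yes v∈σ = σ , st , id , v∈σ
      ... | no v∉σ =
        let i , i-free = free v (proper st) (extends st)
              (λ u∈ → [ inj₁ , inj₂ ∘ s≤s⁻¹ ]′ (early st u∈)) (λ v∈ → v∉σ (_ , v∈))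
        in (v , i) ∷ σ ,
           record
             { proper  = proper-∷ (proper st) (λ v∈ → v∉σ (_ , v∈)) i-free
             ; extends = there ∘ extends st
             ; early   = λ { (here refl) → inj₂ ≤-refl ; (there u∈) → early st u∈ }
             } ,
           there , i , here refl

      color-rank : ∀ {n σ} vs → Stage (suc n) σ →
        ∃[ σ′ ] (Stage (suc n) σ′ × (∀ {s} → s ∈ˡ σ → s ∈ˡ σ′) ×
          All (λ v → rank v ≡ n → Colored σ′ v) vs)
      color-rank [] st = _ , st , id , []
      color-rank {n} (v ∷ vs) st with rank v ℕ.≟ n
      ... | no rank≢n =
        let σ′ , st′ , σ⊆σ′ , all = color-rank vs st
        in σ′ , st′ , σ⊆σ′ , (λ p → contradiction p rank≢n) ∷ all
      ... | yes refl =
        let σ′ , st′ , σ⊆σ′ , i , v∈σ′ = color-vertex v st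
            σ″ , st″ , σ′⊆σ″ , all = color-rank vs st′
        in σ″ , st″ , σ′⊆σ″ ∘ σ⊆σ′ , (λ _ → i , σ′⊆σ″ v∈σ′) ∷ all

      vertices : List (V G)
      vertices = map (Inverse.from (proj₂ (Graph.V-finite G))) (allFin _)

      ∈-vertices : ∀ v → v ∈ˡ vertices
      ∈-vertices v = subst (_∈ˡ vertices) (Inverse.strictlyInverseʳ (proj₂ (Graph.V-finite G)) v)
        (∈-map⁺ _ (∈-allFin _))

      stage : ∀ n → ∃[ σ ] (Stage n σ × (∀ v → rank v < n → Colored σ v))
      stage zero = σ₀ ,
        record { proper = σ₀-proper ; extends = id ; early = inj₁ ∘ σ₀-early } , λ _ ()
      stage (suc n) =
        let σ , st , done = stage n
            σ′ , st′ , σ⊆σ′ , all = color-rank vertices record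
              { proper = proper st ; extends = extends st
              ; early = λ u∈ → [ inj₁ , (λ r<n → inj₂ (≤-trans r<n (n≤1+n _))) ]′ (early st u∈) }
        in σ′ , st′ , λ v r<1+n → [ (λ r<n → let i , v∈σ = done v r<n in i , σ⊆σ′ v∈σ) ,
                                    All.lookup all (∈-vertices v) ]′ (m≤n⇒m<n∨m≡n (s≤s⁻¹ r<1+n))

    greedy-coloring : ∃ IsColoring
    greedy-coloring =
      let _ , st , done = stage bound in
      (λ v → proj₁ (done v (rank<bound v))) ,
      λ u v → proper-¬M (proper st) (proj₂ (done u (rank<bound u))) (proj₂ (done v (rank<bound v)))

-- The graphs E_{k,a,b}

record Admissible (q a b : ℕ) : Set where
  field
    1≤a   : 1 ≤ a
    a<q   : a < q
    1≤b   : 1 ≤ b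
    b<q   : b < q
    q≤a+b : q ≤ a + b

admissible-swap : ∀ {q a b} → Admissible q a b → Admissible q b a
admissible-swap {a = a} {b} adm = record
  { 1≤a = 1≤b ; a<q = b<q ; 1≤b = 1≤a ; b<q = a<q
  ; q≤a+b = ≤-trans q≤a+b (≤-reflexive (+-comm a b)) }
  where open Admissible adm

swap : ∀ {k a b} → EVertex k a b → EVertex k b a
swap (x₁ i) = y₁ i
swap (x₂ i) = y₂ i
swap (y₁ i) = x₁ i
swap (y₂ i) = x₂ i
swap z      = z

swap-swap : ∀ {k a b} (v : EVertex k a b) → swap (swap v) ≡ v
swap-swap (x₁ _) = refl
swap-swap (x₂ _) = refl
swap-swap (y₁ _) = refl
swap-swap (y₂ _) = refl
swap-swap z      = refl

swap-adj : ∀ {k a b} (u v : EVertex k a b) → E k a b ⟨ u ~ v ⟩ → E k b a ⟨ swap u ~ swap v ⟩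
swap-adj {k} {a} {b} u v (u≢v , e) =
  (λ p → u≢v (trans (sym (swap-swap u)) (trans (cong swap p) (swap-swap v)))) , go u v e
  where
  go : ∀ (u v : EVertex k a b) → T (prescribed u v Bool.∨ prescribed v u) →
    T (prescribed (swap u) (swap v) Bool.∨ prescribed (swap v) (swap u))
  go (x₁ _) (x₁ _) _ = tt
  go (x₁ _) (x₂ _) _ = tt
  go (x₁ _) z      _ = tt
  go (x₂ _) (x₁ _) _ = tt
  go (x₂ _) (x₂ _) _ = tt
  go (x₂ _) (y₂ _) _ = tt
  go (y₁ _) (y₁ _) _ = tt
  go (y₁ _) (y₂ _) _ = tt
  go (y₁ _) z      _ = tt
  go (y₂ _) (x₂ _) _ = tt
  go (y₂ _) (y₁ _) _ = tt
  go (y₂ _) (y₂ _) _ = tt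
  go z      (x₁ _) _ = tt
  go z      (y₁ _) _ = tt

-- Exchanging the roles of X and Y turns every fact about the X side into one about the Y side, via
-- `pullback`.
swap-iso : ∀ {k a b} → GraphIso (E k b a) (E k a b)
swap-iso = record
  { to       = swap
  ; from     = swap
  ; to-from  = swap-swap
  ; from-to  = swap-swap
  ; to-adj   = λ {u} {v} → swap-adj u v
  ; from-adj = λ {u} {v} → swap-adj u v
  }

join-≤ : ∀ {m n q} → m + n ≤ q → Fin m ⊎ Fin n → Fin q
join-≤ {m} {n} m+n≤q s = inject≤ (join m n s) m+n≤q

join-≤-injective : ∀ {m n q} (m+n≤q : m + n ≤ q) → Injective _≡_ _≡_ (join-≤ m+n≤q)
join-≤-injective {m} {n} m+n≤q {s} {t} p =
  trans (sym (splitAt-join m n s))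
    (trans (cong (splitAt m) (inject≤-injective m+n≤q m+n≤q (join m n s) (join m n t) p))
           (splitAt-join m n t))

module _ {G : Graph} (v w : V G) where
  private
    _≟ⱽ_ = vertex-≟ G

  -- Serves to list neighbors: in the clique of `v`, the slot of `v` itself is given to `w`, a
  -- neighbor outside the clique.
  replace : V G → V G
  replace u with u ≟ⱽ v
  ... | yes _ = w
  ... | no _  = u

  replace-same : replace v ≡ w
  replace-same with v ≟ⱽ v
  ... | yes _  = refl
  ... | no v≢v = contradiction refl v≢v

  replace-other : ∀ {u} → u ≢ v → replace u ≡ u
  replace-other {u} u≢v with u ≟ⱽ v
  ... | yes u≡v = contradiction u≡v u≢v
  ... | no _    = refl

module _ {q a b : ℕ} (adm : Admissible q a b) where
  open Admissible adm

  x₁° : Fin a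
  x₁° = fromℕ< 1≤a

  x₂° : Fin (q ∸ a)
  x₂° = fromℕ< (m<n⇒0<n∸m a<q)

  2≤q : 2 ≤ q
  2≤q = ≤-trans (s≤s 1≤a) a<q

  |X|≤q : a + (q ∸ a) ≤ q
  |X|≤q = ≤-reflexive (m+[n∸m]≡n (<⇒≤ a<q))

  -- From q ≤ a + b the second summand is at most `a`, and (q - a) + a = q.
  |X₂∪Y₂|≤q : (q ∸ a) + (q ∸ b) ≤ q
  |X₂∪Y₂|≤q = ≤-trans
    (+-monoʳ-≤ (q ∸ a) (m≤n+o⇒m∸n≤o q b (≤-trans q≤a+b (≤-reflexive (+-comm a b)))))
    (≤-reflexive (m∸n+n≡m (<⇒≤ a<q)))

-- Extending precolorings of E_{k,a,b}

module Extend {q a b : ℕ} (adm : Admissible q a b) (D : DPCover (E (suc q) a b) q) where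
  open DPCover D
  open Greedy D

  private
    G = E (suc q) a b
    ⟦X⟧ : Fin a ⊎ Fin (q ∸ a) → V G
    ⟦X⟧ = [ x₁ , x₂ ]′

    ⟦Y⟧ : Fin b ⊎ Fin (q ∸ b) → V G
    ⟦Y⟧ = [ y₁ , y₂ ]′

    ⟦X₂∪Y₂⟧ : Fin (q ∸ a) ⊎ Fin (q ∸ b) → V G
    ⟦X₂∪Y₂⟧ = [ x₂ , y₂ ]′

  -- The remaining vertices are colored greedily in the order X₂, Y₂,
  -- X₁ ∖ {x}, Y₁ ∖ {y}, x, y.  At its turn, every vertex other than x
  -- and y has fewer than q colored neighbors.
  module _ (x : Fin a) (y : Fin b) (y′ : Fin (q ∸ b)) where

    -- `x` and `y` stay open as idle slots for their cliques. With only `y′` allowed from Y₂, a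
    -- vertex of X₂ sees at most one colored vertex outside X at its turn; with Y₁ left out, a
    -- vertex of Y₂ sees only X₂ and Y₂.
    Precolorable : V G → Set
    Precolorable (x₁ i) = i ≢ x
    Precolorable (x₂ _) = ⊤
    Precolorable (y₁ _) = ⊥
    Precolorable (y₂ j) = j ≡ y′
    Precolorable z      = ⊤

    private
      rank₁ : ∀ {n} {i j : Fin n} → Dec (i ≡ j) → ℕ
      rank₁ (yes _) = 3
      rank₁ (no _)  = 2

      -- X₁ and Y₁ are not adjacent, so they can share ranks 2 and 3. The rank of `z` has no bearing
      -- on the order, as `z` lies in `σ₀`.
      rank : V G → ℕ
      rank (x₁ i) = rank₁ (i ≟ x)
      rank (x₂ _) = 0
      rank (y₁ j) = rank₁ (j ≟ y)
      rank (y₂ _) = 1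
      rank z      = 0

      rank₁-refl : ∀ {n} (i : Fin n) → rank₁ (i ≟ i) ≡ 3
      rank₁-refl i with i ≟ i
      ... | yes _  = refl
      ... | no i≢i = contradiction refl i≢i

      2≤rank₁ : ∀ {n} {i j : Fin n} (d : Dec (i ≡ j)) → 2 ≤ rank₁ d
      2≤rank₁ (yes _) = s≤s (s≤s z≤n)
      2≤rank₁ (no _)  = s≤s (s≤s z≤n)

      rank₁<4 : ∀ {n} {i j : Fin n} (d : Dec (i ≡ j)) → rank₁ d < 4
      rank₁<4 (yes _) = s≤s (s≤s (s≤s (s≤s z≤n)))
      rank₁<4 (no _)  = s≤s (s≤s (s≤s z≤n))

      rank<4 : ∀ v → rank v < 4
      rank<4 (x₁ i) = rank₁<4 (i ≟ x)
      rank<4 (x₂ _) = s≤s z≤n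
      rank<4 (y₁ j) = rank₁<4 (j ≟ y)
      rank<4 (y₂ _) = s≤s (s≤s z≤n)
      rank<4 z      = s≤s z≤n

    module _ {σ₀ : Partial} (σ₀-proper : Proper σ₀)
      (σ₀-precolorable : ∀ {u j} → (u , j) ∈ˡ σ₀ → Precolorable u)
      {c e} (z∈σ₀ : (z , c) ∈ˡ σ₀) (y′∈σ₀ : (y₂ y′ , e) ∈ˡ σ₀)
      (y-agree : Agree (y₁ y) (z , c) (y₂ y′ , e))
      -- The pair agreeing at `x` is left open: it will be `z` with a vertex of X₂, two vertices of
      -- X₂, or `z` with a vertex of X₁.
      {u₁ u₂ d₁ d₂} (u₁∈σ₀ : (u₁ , d₁) ∈ˡ σ₀) (u₂∈σ₀ : (u₂ , d₂) ∈ˡ σ₀) (u₁≢u₂ : u₁ ≢ u₂)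
      (u₁~x : G ⟨ u₁ ~ x₁ x ⟩) (u₂~x : G ⟨ u₂ ~ x₁ x ⟩)
      (x-agree : Agree (x₁ x) (u₁ , d₁) (u₂ , d₂)) where

      private
        module _ {σ : Partial} (σ-proper : Proper σ) (σ₀⊆σ : ∀ {s} → s ∈ˡ σ₀ → s ∈ˡ σ) where

          EarlyFor : V G → Set
          EarlyFor v = ∀ {u j} → (u , j) ∈ˡ σ → Precolorable u ⊎ rank u ≤ rank v

          x-uncolored : ∀ {r} → (∀ {u j} → (u , j) ∈ˡ σ → Precolorable u ⊎ rank u ≤ r) → r ≤ 2 →
            Uncolored σ (x₁ x)
          x-uncolored early r≤2 x∈σ with early x∈σ
          ... | inj₁ x≢x = x≢x refl
          ... | inj₂ rank≤r =
            1+n≰n (≤-trans (≤-reflexive (sym (rank₁-refl x))) (≤-trans rank≤r r≤2))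

          y-uncolored : ∀ {r} → (∀ {u j} → (u , j) ∈ˡ σ → Precolorable u ⊎ rank u ≤ r) → r ≤ 2 →
            Uncolored σ (y₁ y)
          y-uncolored early r≤2 y∈σ with early y∈σ
          ... | inj₂ rank≤r =
            1+n≰n (≤-trans (≤-reflexive (sym (rank₁-refl y))) (≤-trans rank≤r r≤2))

          x₁-covers : ∀ i {u j} → (u , j) ∈ˡ σ → G ⟨ u ~ x₁ i ⟩ →
            ∃[ n ] replace {G} (x₁ i) z (⟦X⟧ n) ≡ u
          x₁-covers i {z}     _ _         = inj₁ i , replace-same {G} (x₁ i) _
          x₁-covers i {x₁ i′} _ (u≢v , _) = inj₁ i′ , replace-other {G} _ _ u≢v
          x₁-covers i {x₂ i′} _ (u≢v , _) = inj₂ i′ , replace-other {G} _ _ u≢v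
          x₁-covers i {y₁ _}  _ (_ , ())
          x₁-covers i {y₂ _}  _ (_ , ())

          y₁-covers : ∀ i {u j} → (u , j) ∈ˡ σ → G ⟨ u ~ y₁ i ⟩ →
            ∃[ n ] replace {G} (y₁ i) z (⟦Y⟧ n) ≡ u
          y₁-covers i {z}     _ _         = inj₁ i , replace-same {G} (y₁ i) _
          y₁-covers i {y₁ i′} _ (u≢v , _) = inj₁ i′ , replace-other {G} _ _ u≢v
          y₁-covers i {y₂ i′} _ (u≢v , _) = inj₂ i′ , replace-other {G} _ _ u≢v
          y₁-covers i {x₁ _}  _ (_ , ())
          y₁-covers i {x₂ _}  _ (_ , ())

          x₂-covers : ∀ i → EarlyFor (x₂ i) → ∀ {u j} → (u , j) ∈ˡ σ → G ⟨ u ~ x₂ i ⟩ →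
            ∃[ n ] replace {G} (x₂ i) (y₂ y′) (⟦X⟧ n) ≡ u
          x₂-covers i _ {x₁ i′} _ (u≢v , _) = inj₁ i′ , replace-other {G} _ _ u≢v
          x₂-covers i _ {x₂ i′} _ (u≢v , _) = inj₂ i′ , replace-other {G} _ _ u≢v
          x₂-covers i early {y₂ j} u∈σ _ with early u∈σ
          ... | inj₁ refl = inj₂ i , replace-same {G} (x₂ i) _
          x₂-covers i _ {y₁ _} _ (_ , ())
          x₂-covers i _ {z}    _ (_ , ())

          y₂-covers : ∀ i → EarlyFor (y₂ i) → ∀ {u j} → (u , j) ∈ˡ σ → G ⟨ u ~ y₂ i ⟩ →
            ∃[ n ] ⟦X₂∪Y₂⟧ n ≡ u
          y₂-covers i _ {x₂ i′} _ _ = inj₁ i′ , refl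
          y₂-covers i _ {y₂ i′} _ _ = inj₂ i′ , refl
          y₂-covers i early {y₁ j} u∈σ _ with early u∈σ
          ... | inj₂ rank≤1 = contradiction (≤-trans (2≤rank₁ (j ≟ y)) rank≤1) 1+n≰n
          y₂-covers i _ {x₁ _} _ (_ , ())
          y₂-covers i _ {z}    _ (_ , ())

          free : ∀ v → EarlyFor v → Uncolored σ v → ∃ (Free σ v)
          free z _ z∉σ = contradiction (σ₀⊆σ z∈σ₀) z∉σ
          -- The slot of `x₂ i` itself is taken by `y′`, so the idle slot is that of the uncolored
          -- `x`.
          free (x₂ i) early _ =
            free-if-idle σ-proper (x₂ i) (join-≤ (|X|≤q adm)) (join-≤-injective (|X|≤q adm))
              _ (x₂-covers i early) (inj₁ x)
              (subst (Uncolored σ) (sym (replace-other {G} _ _ λ ())) (x-uncolored early z≤n))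
          -- The slots are X₂ and Y₂, and the one of `y₂ i` itself is idle.
          free (y₂ i) early y₂∉σ =
            free-if-idle σ-proper (y₂ i) (join-≤ (|X₂∪Y₂|≤q adm)) (join-≤-injective (|X₂∪Y₂|≤q adm))
              _ (y₂-covers i early) (inj₂ i) y₂∉σ
          free (x₁ i) early _ with i ≟ x
          ... | yes refl =
            free-if-agree σ-proper (x₁ x) (join-≤ (|X|≤q adm)) (join-≤-injective (|X|≤q adm))
              _ (x₁-covers x) (σ₀⊆σ u₁∈σ₀) (σ₀⊆σ u₂∈σ₀) u₁≢u₂ u₁~x u₂~x x-agree
          ... | no i≢x =
            free-if-idle σ-proper (x₁ i) (join-≤ (|X|≤q adm)) (join-≤-injective (|X|≤q adm))
              _ (x₁-covers i) (inj₁ x)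
              (subst (Uncolored σ) (sym (replace-other {G} _ _ λ { refl → i≢x refl }))
                (x-uncolored early ≤-refl))
          free (y₁ i) early _ with i ≟ y
          ... | yes refl =
            free-if-agree σ-proper (y₁ y) (join-≤ |Y|≤q) (join-≤-injective |Y|≤q)
              _ (y₁-covers y) (σ₀⊆σ z∈σ₀) (σ₀⊆σ y′∈σ₀) (λ ()) ((λ ()) , tt) ((λ ()) , tt) y-agree
            where |Y|≤q = |X|≤q (admissible-swap adm)
          ... | no i≢y =
            free-if-idle σ-proper (y₁ i) (join-≤ |Y|≤q) (join-≤-injective |Y|≤q)
              _ (y₁-covers i) (inj₁ y)
              (subst (Uncolored σ) (sym (replace-other {G} _ _ λ { refl → i≢y refl }))
                (y-uncolored early ≤-refl))
            where |Y|≤q = |X|≤q (admissible-swap adm)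

      extend : ∃ IsColoring
      extend = greedy-coloring σ₀-proper Precolorable σ₀-precolorable rank 4 rank<4
        λ v σ-proper σ₀⊆σ → free σ-proper σ₀⊆σ v

-- Matchings forced by a bad cover of E_{k,a,b}

module X-Side {q a b : ℕ} (adm : Admissible q a b) (D : DPCover (E (suc q) a b) q)
  (unc : DPCover.Uncolorable D) where
  open DPCover D
  open Greedy D
  open Extend adm D

  private
    y° = x₁° (admissible-swap adm)
    x′ = x₂° adm
    y′ = x₂° (admissible-swap adm)

  -- Otherwise these colors of `z`, `x₂ i′` and `y₂ j′` form a proper precoloring with agreement at
  -- `x₁ i` and `y₁ j`, and it extends.
  x₂y₂-adjacent : ∀ {i i′ j j′ c d e} →
    Agree (x₁ i) (z , c) (x₂ i′ , d) → Agree (y₁ j) (z , c) (y₂ j′ , e) → M (x₂ i′) (y₂ j′) d e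
  x₂y₂-adjacent {i} {i′} {j} {j′} {c} {d} {e} x-agree y-agree =
    decidable-stable (M? (x₂ i′) (y₂ j′) d e) λ ¬m → unc
      (extend i j j′ {σ₀ = (z , c) ∷ (x₂ i′ , d) ∷ (y₂ j′ , e) ∷ []}
        ( (((λ ()) , (λ m → proj₂ (M-edge m))) ∷ ((λ ()) , (λ m → proj₂ (M-edge m))) ∷ [])
        ∷ (((λ ()) , (λ m → ¬m (M-sym m))) ∷ [])
        ∷ [] ∷ [])
        (λ { (here refl) → tt ; (there (here refl)) → tt ; (there (there (here refl))) → refl })
        (here refl) (there (there (here refl))) y-agree
        (here refl) (there (here refl)) (λ ()) ((λ ()) , tt) ((λ ()) , tt) x-agree)

  -- If `c` forbids nothing at `x₁ i`, every color of `x′` agrees with it there, so at least two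
  -- colors of `x′` would be adjacent to the same color `e` of `y′`.
  zx₁-perfect : ∀ c i → ∃ (M z (x₁ i) c)
  zx₁-perfect c i = decidable-stable (any? (M? z (x₁ i) c)) λ none →
    let e , agree = agreeing-color z (y₁ y°) (y₂ y′) c
        m : ∀ d → M (x₂ x′) (y₂ y′) d e
        m d = x₂y₂-adjacent {i = i} {d = d} (λ m → contradiction (_ , m) none) agree
        d′ , d′≢d = other (2≤q adm) c
    in d′≢d (M-injective (m d′) (m c))

  -- If `j` has no partner, neither has some color `d` of `x₂ i′`, which then agrees with every
  -- color of `z`. For another color `d′`, choose `c` agreeing with `d′` and `e` agreeing with `c`:
  -- both `d` and `d′` would be adjacent to `e`.
  x₁x₂-perfect : ∀ i i′ j → ∃ (M (x₁ i) (x₂ i′) j)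
  x₁x₂-perfect i i′ j = decidable-stable (any? (M? (x₁ i) (x₂ i′) j)) λ none →
    let d , ¬m = unmatched j none
        d′ , d′≢d = other (2≤q adm) d
        c , x-agree = agreeing-color (x₂ i′) (x₁ i) z d′
        e , y-agree = agreeing-color z (y₁ y°) (y₂ y′) c
    in d′≢d (M-injective
         (x₂y₂-adjacent {i = i} (agree-sym {s = x₂ i′ , d′} {t = z , c} x-agree) y-agree)
         (x₂y₂-adjacent {i = i} (λ _ m → contradiction (_ , M-sym m) ¬m) y-agree))

module X-Aligned {q a b : ℕ} (adm : Admissible q a b) (D : DPCover (E (suc q) a b) q)
  (unc : DPCover.Uncolorable D) where
  open DPCover D
  open Greedy D
  open Extend adm D
  open X-Side adm D unc
  module Y-Side = X-Side (admissible-swap adm)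
    (pullback swap-iso D) (pullback-uncolorable swap-iso D unc)

  zy₁-perfect : ∀ c j → ∃ (M z (y₁ j) c)
  zy₁-perfect = Y-Side.zx₁-perfect

  y₁y₂-perfect : ∀ i i′ j → ∃ (M (y₁ i) (y₂ i′) j)
  y₁y₂-perfect = Y-Side.x₁x₂-perfect

  -- Lab c v j says that color j of v corresponds to color c of z.
  Lab : Fin q → EVertex (suc q) a b → Fin q → Set
  Lab c (x₁ i) j = M z (x₁ i) c j
  Lab c (x₂ i) j = ∃[ i′ ] ∃[ j′ ] (M z (x₁ i′) c j′ × M (x₁ i′) (x₂ i) j′ j)
  Lab c (y₁ i) j = M z (y₁ i) c j
  Lab c (y₂ i) j = ∃[ i′ ] ∃[ j′ ] (M z (y₁ i′) c j′ × M (y₁ i′) (y₂ i) j′ j)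
  Lab c z      j = c ≡ j

  private
    x° = x₁° adm
    y° = x₁° (admissible-swap adm)
    y′ = x₂° (admissible-swap adm)

  lab-total : ∀ c v → ∃ (Lab c v)
  lab-total c (x₁ i) = zx₁-perfect c i
  lab-total c (x₂ i) =
    let j′ , m = zx₁-perfect c x° ; j , m′ = x₁x₂-perfect x° i j′ in j , x° , j′ , m , m′
  lab-total c (y₁ i) = zy₁-perfect c i
  lab-total c (y₂ i) =
    let j′ , m = zy₁-perfect c y° ; j , m′ = y₁y₂-perfect y° i j′ in j , y° , j′ , m , m′
  lab-total c z      = c , refl

  -- Both ends of such a path forbid exactly the middle color `j` at `v`.
  path-agree : ∀ {u v w c j d} → M u v c j → M v w j d → Agree v (u , c) (w , d)
  path-agree m m′ m₁ m₂ = trans (M-functional m₁ m) (M-functional m′ₛ m₂)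
    where m′ₛ = M-sym m′

  lab-x₂y₂ : ∀ {c i j d e} → Lab c (x₂ i) d → Lab c (y₂ j) e → M (x₂ i) (y₂ j) d e
  lab-x₂y₂ (_ , _ , m₁ , m₂) (_ , _ , m₃ , m₄) =
    x₂y₂-adjacent (path-agree m₁ m₂) (path-agree m₃ m₄)

  -- The partner `d′` of `j` also has label `c`. Both `d` and `d′` are adjacent to the label-`c`
  -- color `e` of `y′`, so they coincide; labels on X₂ thus do not depend on the path.
  lab-x₁x₂ : ∀ {c i i′ j d} → Lab c (x₁ i) j → Lab c (x₂ i′) d → M (x₁ i) (x₂ i′) j d
  lab-x₁x₂ {c} {i} {i′} {j} m lab =
    let d′ , m′ = x₁x₂-perfect i i′ j
        e , lab-e = lab-total c (y₂ y′)
        d′≡d = M-injective (lab-x₂y₂ (i , j , m , m′) lab-e) (lab-x₂y₂ lab lab-e)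
    in subst (M (x₁ i) (x₂ i′) j) d′≡d m′

  lab-injective-x₁ : ∀ {c c′ i j} → Lab c (x₁ i) j → Lab c′ (x₁ i) j → c ≡ c′
  lab-injective-x₁ = M-injective

  lab-injective-x₂ : ∀ {c c′ i d} → Lab c (x₂ i) d → Lab c′ (x₂ i) d → c ≡ c′
  lab-injective-x₂ {c} {c′} lab lab′ =
    let j , m = zx₁-perfect c x°
        j′ , m′ = zx₁-perfect c′ x°
        j≡j′ = M-injective (lab-x₁x₂ m lab) (lab-x₁x₂ m′ lab′)
    in M-injective m (subst (M z (x₁ x°) c′) (sym j≡j′) m′)

  -- If `d` and `d′` were not adjacent, both could be precolored: they agree at `x°`, since each is
  -- joined to its label-`c` color.
  lab-x₂x₂ : ∀ {c i i′ d d′} → i ≢ i′ → Lab c (x₂ i) d → Lab c (x₂ i′) d′ → M (x₂ i) (x₂ i′) d d′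
  lab-x₂x₂ {c} {i} {i′} {d} {d′} i≢i′ lab lab′ =
    decidable-stable (M? (x₂ i) (x₂ i′) d d′) λ ¬m →
    let j , m = zx₁-perfect c x°
        f , lab-f = lab-total c (y₂ y′)
        -- Only `f` at `y′` is adjacent to `d` or `d′`, so `e` conflicts with neither; `c′` is then
        -- chosen at `z` to agree with `e` at `y°`.
        e , e≢f = other (2≤q adm) f
        c′ , y-agree = agreeing-color (y₂ y′) (y₁ y°) z e
    in unc (extend x° y° y′ {σ₀ = (z , c′) ∷ (x₂ i , d) ∷ (x₂ i′ , d′) ∷ (y₂ y′ , e) ∷ []}
        ( (((λ ()) , (λ m → proj₂ (M-edge m))) ∷ ((λ ()) , (λ m → proj₂ (M-edge m)))
          ∷ ((λ ()) , (λ m → proj₂ (M-edge m))) ∷ [])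
        ∷ (((λ { refl → i≢i′ refl }) , (λ m → ¬m (M-sym m)))
          ∷ ((λ ()) , (λ m → e≢f (M-functional (M-sym m) (lab-x₂y₂ lab lab-f)))) ∷ [])
        ∷ (((λ ()) , (λ m → e≢f (M-functional (M-sym m) (lab-x₂y₂ lab′ lab-f)))) ∷ [])
        ∷ [] ∷ [])
        (λ { (here refl) → tt ; (there (here refl)) → tt ; (there (there (here refl))) → tt
           ; (there (there (there (here refl)))) → refl })
        (here refl) (there (there (there (here refl))))
        (agree-sym {s = y₂ y′ , e} {t = z , c′} y-agree)
        (there (here refl)) (there (there (here refl))) (λ { refl → i≢i′ refl })
        ((λ ()) , tt) ((λ ()) , tt)
        (λ m₁ m₂ → trans (M-functional m₁ (M-sym (lab-x₁x₂ m lab)))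
                         (sym (M-functional m₂ (M-sym (lab-x₁x₂ m lab′))))))

  -- By `disagree`, no color of `z` other than `c` agrees with `j` at `x₁ i′`. Yet some color of `z`
  -- does, so it is `c`, and the partner of `j` must be the partner `j′` of `c`. A missing partner
  -- would make every color of `z` agree.
  lab-x₁x₁ : ∀ {c i i′ j j′} → i ≢ i′ → Lab c (x₁ i) j → Lab c (x₁ i′) j′ → M (x₁ i) (x₁ i′) j j′
  lab-x₁x₁ {c} {i} {i′} {j} {j′} i≢i′ lab lab′ = matched (any? (M? (x₁ i) (x₁ i′) j))
    where
    disagree : ∀ {d} → d ≢ c → ¬ Agree (x₁ i′) (z , d) (x₁ i , j)
    disagree {d} d≢c agree =
      -- Giving `y′` its label-`d` color secures agreement with `d` at `y`, the middle of the
      -- labelling path.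
      let e , y , f , m , m′ = lab-total d (y₂ y′)
      in unc (extend i′ y y′ {σ₀ = (z , d) ∷ (x₁ i , j) ∷ (y₂ y′ , e) ∷ []}
        ( (((λ ()) , (λ m → d≢c (M-functional m (M-sym lab))))
          ∷ ((λ ()) , (λ m → proj₂ (M-edge m))) ∷ [])
        ∷ (((λ ()) , (λ m → proj₂ (M-edge m))) ∷ [])
        ∷ [] ∷ [])
        (λ { (here refl) → tt ; (there (here refl)) → i≢i′ ; (there (there (here refl))) → refl })
        (here refl) (there (there (here refl))) (path-agree m m′)
        (here refl) (there (here refl)) (λ ()) ((λ ()) , tt)
        ((λ { refl → i≢i′ refl }) , tt) agree)

    matched : Dec (∃ (M (x₁ i) (x₁ i′) j)) → M (x₁ i) (x₁ i′) j j′
    matched (no none) =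
      let d , d≢c = other (2≤q adm) c
      in ⊥-elim (disagree d≢c λ _ m → contradiction (_ , m) none)
    matched (yes (e , m)) with agreeing-color (x₁ i) (x₁ i′) z j
    ... | d , agree with d ≟ c
    ...   | no d≢c = ⊥-elim (disagree d≢c (agree-sym {s = x₁ i , j} {t = z , d} agree))
    ...   | yes refl = subst (M (x₁ i) (x₁ i′) j) (agree m lab′) m

-- Robustness of E_{k,a,b}

module _ {q a b : ℕ} (adm : Admissible q a b) where
  private
    G = E (suc q) a b

  E-aligned : (D : DPCover G q) → DPCover.Uncolorable D → DPCover.Aligned D
  E-aligned D unc = col , col-injective , λ {u} {v} e c → lab-M u v e (col-lab c u) (col-lab c v)
    where
    open DPCover D
    module XA = X-Aligned adm D unc
    module YA = X-Aligned (admissible-swap adm)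
      (pullback swap-iso D) (pullback-uncolorable swap-iso D unc)
    open XA using (Lab; lab-total)

    col : V G → Fin q → Fin q
    col v c = proj₁ (lab-total c v)

    col-lab : ∀ c v → Lab c v (col v c)
    col-lab c v = proj₂ (lab-total c v)

    lab-injective : ∀ v {c c′ j} → Lab c v j → Lab c′ v j → c ≡ c′
    lab-injective (x₁ _) = XA.lab-injective-x₁
    lab-injective (x₂ _) = XA.lab-injective-x₂
    lab-injective (y₁ _) = YA.lab-injective-x₁
    lab-injective (y₂ _) = YA.lab-injective-x₂
    lab-injective z refl refl = refl

    col-injective : ∀ v → Injective _≡_ _≡_ (col v)
    col-injective v {c} {c′} p =
      lab-injective v (col-lab c v) (subst (Lab c′ v) (sym p) (col-lab c′ v))

    lab-M : ∀ u v → G ⟨ u ~ v ⟩ → ∀ {c i j} → Lab c u i → Lab c v j → M u v i j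
    lab-M (x₁ _) (x₁ _) (u≢v , _) l l′ = XA.lab-x₁x₁ (λ { refl → u≢v refl }) l l′
    lab-M (x₁ _) (x₂ _) _ l l′ = XA.lab-x₁x₂ l l′
    lab-M (x₁ _) z      _ l refl = M-sym l
    lab-M (x₂ _) (x₁ _) _ l l′ = M-sym (XA.lab-x₁x₂ l′ l)
    lab-M (x₂ _) (x₂ _) (u≢v , _) l l′ = XA.lab-x₂x₂ (λ { refl → u≢v refl }) l l′
    lab-M (x₂ _) (y₂ _) _ l l′ = XA.lab-x₂y₂ l l′
    lab-M (y₁ _) (y₁ _) (u≢v , _) l l′ = YA.lab-x₁x₁ (λ { refl → u≢v refl }) l l′
    lab-M (y₁ _) (y₂ _) _ l l′ = YA.lab-x₁x₂ l l′
    lab-M (y₁ _) z      _ l refl = M-sym l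
    lab-M (y₂ _) (x₂ _) _ l l′ = M-sym (XA.lab-x₂y₂ l′ l)
    lab-M (y₂ _) (y₁ _) _ l l′ = M-sym (YA.lab-x₁x₂ l′ l)
    lab-M (y₂ _) (y₂ _) (u≢v , _) l l′ = YA.lab-x₂x₂ (λ { refl → u≢v refl }) l l′
    lab-M z      (x₁ _) _ refl l′ = l′
    lab-M z      (y₁ _) _ refl l′ = l′

  E-neighbor : ∀ v → ∃[ u ] G ⟨ v ~ u ⟩
  E-neighbor (x₁ _) = z , (λ ()) , tt
  E-neighbor (x₂ _) = x₁ (x₁° adm) , (λ ()) , tt
  E-neighbor (y₁ _) = z , (λ ()) , tt
  E-neighbor (y₂ _) = y₁ (x₁° (admissible-swap adm)) , (λ ()) , tt
  E-neighbor z      = x₁ (x₁° adm) , (λ ()) , tt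

  -- Since `E-aligned` is available, no explicit coloring is constructed: `w` has a neighbor, so
  -- dropping its edges leaves a colorable diagonal cover.
  E-delete-vertex : ∀ w → ColorableWithout G q w
  E-delete-vertex w =
    let u , w~u = E-neighbor w
        c , c-proper = missing-edge-colorable {G = G}
          (fromℕ< (≤-trans (s≤s z≤n) (2≤q adm))) E-aligned
          (λ u v → G ⟨ u ~ v ⟩ × u ≢ w × v ≢ w)
          (λ u v → Graph._~?_ G u v ×-dec ¬? (vertex-≟ G u w) ×-dec ¬? (vertex-≟ G v w))
          (λ {u} {v} (e , p , p′) → Graph.~-sym G {u} {v} e , p′ , p)
          proj₁ w~u (λ (_ , w≢w , _) → w≢w refl)
    in extend-by-zero {G = G} (λ v _ → c v) λ e u≢w v≢w → c-proper (e , u≢w , v≢w)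

  -- X is a clique on `q` vertices and so uses every color, including that of `z`, which cannot
  -- occur on X₁ because `z` is adjacent to all of it.
  X₂-meets-color-of-z : ((c , _) : Colorable G q) → ∃[ i ] c (x₂ i) ≡ c z
  X₂-meets-color-of-z (c , h) = go (proj₁ hit) (proj₂ hit)
    where
    a≤q = <⇒≤ (Admissible.a<q adm)

    clique : Fin a ⊎ Fin (q ∸ a) → V G
    clique = [ x₁ , x₂ ]′

    clique-injective : ∀ s t → c (clique s) ≡ c (clique t) → s ≡ t
    clique-injective (inj₁ i) (inj₁ j) p with i ≟ j
    ... | yes refl = refl
    ... | no i≢j   = contradiction p (h ((λ { refl → i≢j refl }) , tt))
    clique-injective (inj₂ i) (inj₂ j) p with i ≟ j
    ... | yes refl = refl
    ... | no i≢j   = contradiction p (h ((λ { refl → i≢j refl }) , tt))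
    clique-injective (inj₁ _) (inj₂ _) p = contradiction p (h ((λ ()) , tt))
    clique-injective (inj₂ _) (inj₁ _) p = contradiction p (h ((λ ()) , tt))

    position : Fin q → Fin a ⊎ Fin (q ∸ a)
    position i = splitAt a (cast (sym (m+[n∸m]≡n a≤q)) i)

    position-injective : Injective _≡_ _≡_ position
    position-injective {i} {j} p = cast-injective
      (trans (sym (join-splitAt a _ _)) (trans (cong (join a _) p) (join-splitAt a _ _)))
      where
      eq = m+[n∸m]≡n a≤q
      cast-injective : cast (sym eq) i ≡ cast (sym eq) j → i ≡ j
      cast-injective p = trans (sym (cast-involutive eq (sym eq) i))
        (trans (cong (cast eq) p) (cast-involutive eq (sym eq) j))

    hit : ∃[ s ] c (clique s) ≡ c z
    hit = let i , p = injective⇒surjective (c ∘ clique ∘ position)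
                        (λ p → position-injective (clique-injective _ _ p)) (c z)
          in position i , p

    go : ∀ s → c (clique s) ≡ c z → ∃[ i ] c (x₂ i) ≡ c z
    go (inj₁ i) p = contradiction p (h ((λ ()) , tt))
    go (inj₂ i) p = i , p

E-robust : ∀ {q a b} → Admissible q a b → Robust q (E (suc q) a b)
E-robust adm = record
  { uncolorable   = λ (c , h) →
      let i , p = X₂-meets-color-of-z adm (c , λ {u} {v} → h {u} {v})
          j , p′ = X₂-meets-color-of-z (admissible-swap adm)
                     (c ∘ swap , λ {u} {v} e → h (swap-adj u v e))
      -- The color of `z` occurs on both X₂ and Y₂, which are completely joined.
      in h {x₂ i} {y₂ j} ((λ ()) , tt) (trans p (sym p′))
  ; delete-vertex = E-delete-vertex adm
  ; aligned       = E-aligned adm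
  }

E-robustly-critical : ∀ k a b → 3 ≤ k → 1 ≤ a → a ≤ k ∸ 2 → 1 ≤ b → b ≤ k ∸ 2 → k ∸ 1 ≤ a + b →
  RobustlyCritical (E k a b)
E-robustly-critical (suc (suc k)) a b _ 1≤a a≤k 1≤b b≤k 1+k≤a+b =
  suc (suc k) , s≤s z≤n , robust⇒robustly-critical (E-robust record
    { 1≤a = 1≤a ; a<q = s≤s a≤k ; 1≤b = 1≤b ; b<q = s≤s b≤k ; q≤a+b = 1+k≤a+b })
E-robustly-critical 1 _ _ (s≤s ())

proposition1p9 : (∀ (k a b : ℕ) → 3 ≤ k →
    1 ≤ a → a ≤ k ∸ 2 → 1 ≤ b → b ≤ k ∸ 2 → k ∸ 1 ≤ a + b →
    RobustlyCritical (E k a b))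
    × (∀ (G : Graph) → RobustlyCritical G →
    ∀ (t : ℕ) → RobustlyCritical (G ∨ complete t))
proposition1p9 = E-robustly-critical , robustly-critical-join
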